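{- Let $d\ge 2$ be an integer and let $\mathfrak{F}$ be either an ordered field or a field that has more than two elements, with universe $F$. Let $\mathcal{G}$ be an FFD coordinate geometry over $\mathfrak{F}$ (of dimension $d$), and let $\mathsf{R}\subseteq (F^d)^n$ be an $n$-ary relation on the points $F^d$, for some $n\ge 1$. Then the following statements are equivalent: (i) $\mathsf{R}$ is a concept of $\mathcal{G}$, i.e. $\mathsf{R}$ is definable in $\mathcal{G}$; (ii) $\mathsf{R}$ is definable over $\mathfrak{F}$ and is closed under all automorphisms of $\mathcal{G}$; (iii) $\mathsf{R}$ is definable over $\mathfrak{F}$ and is closed under all affine automorphisms of $\mathcal{G}$.
   Context: A field is $\langle F,+,\cdot,0,1\rangle$; an ordered field is $\langle F,+,\cdot,0,1,\le\rangle$. "Definable" always means first-order definable without parameters: an $n$-ary relation $\mathsf{S}$ on the universe $M$ of a model $\mathfrak{M}$ is definable in $\mathfrak{M}$ iff there is a formula $\varphi(v_1,\dots,v_n)$ of the language of $\mathfrak{M}$ with $(a_1,\dots,a_n)\in\mathsf{S}\iff \mathfrak{M}\models\varphi[a_1,\dots,a_n]$; definable relations are called concepts of $\mathfrak{M}$. For $\vec p=\langle p_1,\dots,p_d\rangle\in F^d$, the collinearity relation is ${\mathsf{Col}}(\vec p,\vec q,\vec r)$ iff $\vec q=\vec p+\lambda(\vec r-\vec p)$ for some $\lambda\in F$ or $\vec r=\vec p$; for an ordered field, the betweenness relation is ${\mathsf{Bw}}(\vec p,\vec q,\vec r)$ iff $\vec q=\vec p+\lambda(\vec r-\vec p)$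 for some $\lambda\in F$ with $0\le\lambda\le 1$. An $n$-ary relation $\mathsf{R}$ on $F^d$ is definable over $\mathfrak{F}$ iff the $dn$-ary relation $\widehat{\mathsf{R}}=\{(p_{11},\dots,p_{1d},\dots,p_{n1},\dots,p_{nd}) : (\langle p_{11},\dots,p_{1d}\rangle,\dots,\langle p_{n1},\dots,p_{nd}\rangle)\in\mathsf{R}\}$ on $F$ is definable in $\mathfrak{F}$. A ($d$-dimensional) coordinate geometry over a field $\mathfrak{F}$ is a first-order model $\mathcal{G}$ whose universe is $F^d$, whose language contains only relation symbols (no functions or constants), and in which ${\mathsf{Col}}$ is definable. A coordinate geometry over an ordered field $\mathfrak{F}$ is defined the same way, with ${\mathsf{Bw}}$ in place of ${\mathsf{Col}}$. A coordinate geometry is field-definable if all its relations are definable over $\mathfrak{F}$, and FFD (finitely field-definable) if it is field-definable and has only finitely many relations. An affine transformation of $F^d$ is a map $\tau\circ L$ with $L$ an invertible linear map $F^d\to F^d$ and $\tau$ a translation. An affine automorphism of $\mathcal{G}$ is an automorphism of $\mathcal{G}$ that is an affine transformation. A relation $\mathsf{R}$ is closed under $f$ if $(a_1,\dots,a_n)\in\mathsf{R}$ implies $(f(a_1),\dots,f(a_n))\in\mathsf{R}$. -}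

module Defs where

open import Algebra.Bundles using (CommutativeRing)
open import Algebra.Module.Bundles.Raw using (RawLeftModule)
open import Algebra.Module.Morphism.Structures using (module LeftModuleMorphisms)
open import Data.Empty using (⊥)
open import Data.Fin.Base using (Fin; combine)
open import Data.Fin.Patterns using (0F; 1F; 2F)
open import Data.Nat.Base as ℕ using (ℕ; suc)
open import Data.Product.Base using (∃; ∃-syntax; _×_; _,_)
open import Data.Sum.Base using (_⊎_)
open import Data.Unit.Base using (⊤)
open import Data.Vec.Functional using (Vector; _∷_)
open import Data.Vec.Functional.Relation.Binary.Pointwise using (Pointwise)
open import Function.Base using (_∘_)
open import Function.Bundles using (_⇔_; _↔_)
open import Function.Definitions using (Injective)
open import Function.Structures using (IsBijection)
open import Level using (Level; _⊔_; Lift) renaming (suc to lsuc)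
open import Relation.Binary.Bundles using (Setoid)
open import Relation.Binary.Core using (Rel)
open import Relation.Binary.Definitions using (_Respects_)
open import Relation.Binary.PropositionalEquality.Core using (_≡_)
open import Relation.Binary.Structures using (IsTotalOrder)
open import Relation.Nullary.Negation.Core using (¬_)

private
  variable
    c ℓ r s : Level
    n : ℕ

record Signature : Set₁ where
  field
    FunSym   : Set
    funArity : FunSym → ℕ
    RelSym   : Set
    relArity : RelSym → ℕ

module _ (S : Signature) where
  open Signature S

  data Term (n : ℕ) : Set where
    var : Fin n → Term n
    fun : (f : FunSym) → Vector (Term n) (funArity f) → Term n

  infix  7 _≐_
  infixr 6 _∧̇_
  infixr 5 _∨̇_
  infixr 4 _⇒̇_

  -- Formulas in n free variables.  A quantifier binds variable zero and
  -- shifts the others up; ¬ φ is φ ⇒̇ ⊥̇.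
  data Formula (n : ℕ) : Set where
    _≐_            : Term n → Term n → Formula n
    rel            : (R : RelSym) → Vector (Term n) (relArity R) → Formula n
    ⊥̇              : Formula n
    _∧̇_ _∨̇_ _⇒̇_    : Formula n → Formula n → Formula n
    ∀̇_ ∃̇_          : Formula (suc n) → Formula n

-- The setoid equality of the universe plays the role of identity.
record Structure (S : Signature) c ℓ r : Set (lsuc (c ⊔ ℓ ⊔ r)) where
  open Signature S
  field
    universe : Setoid c ℓ
  open Setoid universe public using (Carrier; _≈_)
  field
    ⟦fun⟧ : (f : FunSym) → Vector Carrier (funArity f) → Carrier
    ⟦rel⟧ : (R : RelSym) → Vector Carrier (relArity R) → Set r
    ⟦fun⟧-cong : ∀ f {xs ys} → Pointwise _≈_ xs ys → ⟦fun⟧ f xs ≈ ⟦fun⟧ f ys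
    ⟦rel⟧-resp : ∀ R → ⟦rel⟧ R Respects Pointwise _≈_

module _ {S : Signature} (𝔐 : Structure S c ℓ r) where
  open Signature S
  open Structure 𝔐

  eval : Vector Carrier n → Term S n → Carrier
  eval ρ (var i)    = ρ i
  eval ρ (fun f ts) = ⟦fun⟧ f (λ i → eval ρ (ts i))

  infix 3 _⊨_

  _⊨_ : Vector Carrier n → Formula S n → Set (c ⊔ ℓ ⊔ r)
  ρ ⊨ (t ≐ u)    = Lift (c ⊔ r) (eval ρ t ≈ eval ρ u)
  ρ ⊨ (rel R ts) = Lift (c ⊔ ℓ) (⟦rel⟧ R (λ i → eval ρ (ts i)))
  ρ ⊨ ⊥̇          = Lift (c ⊔ ℓ ⊔ r) ⊥
  ρ ⊨ (φ ∧̇ ψ)    = (ρ ⊨ φ) × (ρ ⊨ ψ)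
  ρ ⊨ (φ ∨̇ ψ)    = (ρ ⊨ φ) ⊎ (ρ ⊨ ψ)
  ρ ⊨ (φ ⇒̇ ψ)    = ρ ⊨ φ → ρ ⊨ ψ
  ρ ⊨ (∀̇ φ)      = ∀ x → (x ∷ ρ) ⊨ φ
  ρ ⊨ (∃̇ φ)      = ∃[ x ] ((x ∷ ρ) ⊨ φ)

  Definable : (Vector Carrier n → Set s) → Set (c ⊔ ℓ ⊔ r ⊔ s)
  Definable {n = n} R = ∃[ φ ] ((xs : Vector Carrier n) → R xs ⇔ (xs ⊨ φ))

  record IsAutomorphism (f : Carrier → Carrier) : Set (c ⊔ ℓ ⊔ r) where
    field
      isBijection : IsBijection _≈_ _≈_ f
      preserves-fun : ∀ g xs → f (⟦fun⟧ g xs) ≈ ⟦fun⟧ g (f ∘ xs)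
      preserves-rel : ∀ R xs → ⟦rel⟧ R xs ⇔ ⟦rel⟧ R (f ∘ xs)

ClosedUnder : {A : Set c} → (A → A) → (Vector A n → Set s) → Set (c ⊔ s)
ClosedUnder f R = ∀ xs → R xs → R (f ∘ xs)

record Field c ℓ : Set (lsuc (c ⊔ ℓ)) where
  field
    commutativeRing : CommutativeRing c ℓ
  open CommutativeRing commutativeRing public
  field
    1≉0     : ¬ (1# ≈ 0#)
    inverse : ∀ x → ¬ (x ≈ 0#) → ∃[ y ] (x * y ≈ 1#)

record OrderedField c ℓ : Set (lsuc (c ⊔ ℓ)) where
  field
    field′ : Field c ℓ
  open Field field′ public
  infix 4 _≤_
  field
    _≤_          : Rel Carrier ℓ
    isTotalOrder : IsTotalOrder _≈_ _≤_
    +-monoˡ-≤    : ∀ {x y} z → x ≤ y → x + z ≤ y + z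
    *-nonNeg     : ∀ {x y} → 0# ≤ x → 0# ≤ y → 0# ≤ x * y

MoreThanTwoElements : Field c ℓ → Set (c ⊔ ℓ)
MoreThanTwoElements F = ∃[ xs ] Injective {A = Fin 3} _≡_ (Field._≈_ F) xs

data FieldFun : Set where
  plus times nought one : FieldFun

fieldFunArity : FieldFun → ℕ
fieldFunArity plus   = 2
fieldFunArity times  = 2
fieldFunArity nought = 0
fieldFunArity one    = 0

module _ (F : Field c ℓ) where
  open Field F

  fieldFun : (f : FieldFun) → Vector Carrier (fieldFunArity f) → Carrier
  fieldFun plus   xs = xs 0F + xs 1F
  fieldFun times  xs = xs 0F * xs 1F
  fieldFun nought _  = 0#
  fieldFun one    _  = 1#

  fieldFun-cong : ∀ f {xs ys} → Pointwise _≈_ xs ys → fieldFun f xs ≈ fieldFun f ys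
  fieldFun-cong plus   eq = +-cong (eq 0F) (eq 1F)
  fieldFun-cong times  eq = *-cong (eq 0F) (eq 1F)
  fieldFun-cong nought eq = refl
  fieldFun-cong one    eq = refl

data BaseField c ℓ : Set (lsuc (c ⊔ ℓ)) where
  plain   : (F : Field c ℓ) → MoreThanTwoElements F → BaseField c ℓ
  ordered : OrderedField c ℓ → BaseField c ℓ

underlyingField : BaseField c ℓ → Field c ℓ
underlyingField (plain F _) = F
underlyingField (ordered F) = OrderedField.field′ F

BaseRelSym : BaseField c ℓ → Set
BaseRelSym (plain _ _) = ⊥
BaseRelSym (ordered _) = ⊤

baseSignature : BaseField c ℓ → Signature
baseSignature 𝔉 = record
  { FunSym = FieldFun     ; funArity = fieldFunArity
  ; RelSym = BaseRelSym 𝔉 ; relArity = λ _ → 2 }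

baseRel : (𝔉 : BaseField c ℓ) → BaseRelSym 𝔉 →
          Vector (Field.Carrier (underlyingField 𝔉)) 2 → Set ℓ
baseRel (ordered F) _ xs = OrderedField._≤_ F (xs 0F) (xs 1F)

baseRel-resp : (𝔉 : BaseField c ℓ) (S : BaseRelSym 𝔉) →
               baseRel 𝔉 S Respects Pointwise (Field._≈_ (underlyingField 𝔉))
baseRel-resp (ordered F) _ eq x≤y = ≤-respʳ-≈ (eq 1F) (≤-respˡ-≈ (eq 0F) x≤y)
  where open IsTotalOrder (OrderedField.isTotalOrder F)

baseStructure : (𝔉 : BaseField c ℓ) → Structure (baseSignature 𝔉) c ℓ ℓ
baseStructure 𝔉 = record
  { universe   = Field.setoid (underlyingField 𝔉)
  ; ⟦fun⟧      = fieldFun (underlyingField 𝔉)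
  ; ⟦rel⟧      = baseRel 𝔉
  ; ⟦fun⟧-cong = fieldFun-cong (underlyingField 𝔉)
  ; ⟦rel⟧-resp = baseRel-resp 𝔉
  }

module _ (F : Field c ℓ) (d : ℕ) where
  open Field F

  coordinateSpace : RawLeftModule Carrier c ℓ
  coordinateSpace = record
    { Carrierᴹ = Vector Carrier d
    ; _≈ᴹ_     = Pointwise _≈_
    ; _+ᴹ_     = λ p q i → p i + q i
    ; _*ₗ_     = λ a p i → a * p i
    ; 0ᴹ       = λ _ → 0#
    ; -ᴹ_      = λ p i → - p i
    }

  open RawLeftModule coordinateSpace

  pointSetoid : Setoid c ℓ
  pointSetoid = record
    { Carrier = Carrierᴹ
    ; _≈_ = _≈ᴹ_
    ; isEquivalence = record
      { refl  = λ _ → refl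
      ; sym   = λ p≈q i → sym (p≈q i)
      ; trans = λ p≈q q≈r i → trans (p≈q i) (q≈r i)
      }
    }

  Collinear : (p q r : Carrierᴹ) → Set (c ⊔ ℓ)
  Collinear p q r = (∃[ a ] q ≈ᴹ p +ᴹ (a *ₗ (r +ᴹ (-ᴹ p)))) ⊎ r ≈ᴹ p

  open LeftModuleMorphisms coordinateSpace coordinateSpace
    using (IsLeftModuleIsomorphism)

  record IsAffineTransformation (f : Carrierᴹ → Carrierᴹ) : Set (c ⊔ ℓ) where
    field
      linearPart        : Carrierᴹ → Carrierᴹ
      linearPart-linear : IsLeftModuleIsomorphism linearPart
      translation       : Carrierᴹ
      decomposition     : ∀ p → f p ≈ᴹ linearPart p +ᴹ translation

module _ (F : OrderedField c ℓ) (d : ℕ) where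
  open OrderedField F
  open RawLeftModule (coordinateSpace field′ d)

  Between : (p q r : Carrierᴹ) → Set (c ⊔ ℓ)
  Between p q r =
    ∃[ a ] (0# ≤ a × a ≤ 1# × q ≈ᴹ p +ᴹ (a *ₗ (r +ᴹ (-ᴹ p))))

Point : BaseField c ℓ → ℕ → Set c
Point 𝔉 d = Setoid.Carrier (pointSetoid (underlyingField 𝔉) d)

PointEq : (𝔉 : BaseField c ℓ) (d : ℕ) → Rel (Point 𝔉 d) ℓ
PointEq 𝔉 d = Setoid._≈_ (pointSetoid (underlyingField 𝔉) d)

basicRelation : (𝔉 : BaseField c ℓ) (d : ℕ) → Vector (Point 𝔉 d) 3 → Set (c ⊔ ℓ)
basicRelation (plain F _) d ps = Collinear F d (ps 0F) (ps 1F) (ps 2F)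
basicRelation (ordered F) d ps = Between F d (ps 0F) (ps 1F) (ps 2F)

-- R̂ : the concatenation of the coordinate tuples of n points is read back
-- as n points, coordinate j of point i being at position i * d + j.
coordinatize : {A : Set c} {d : ℕ} →
               (Vector (Vector A d) n → Set s) → Vector A (n ℕ.* d) → Set s
coordinatize R xs = R (λ i j → xs (combine i j))

DefinableOver : (𝔉 : BaseField c ℓ) {d : ℕ} →
                (Vector (Point 𝔉 d) n → Set s) → Set (c ⊔ ℓ ⊔ s)
DefinableOver 𝔉 R = Definable (baseStructure 𝔉) (coordinatize R)

record CoordinateGeometry (𝔉 : BaseField c ℓ) (d : ℕ) r
       : Set (lsuc (c ⊔ ℓ ⊔ r)) where
  field
    Symbol : Set
    arity  : Symbol → ℕ
    ⟦_⟧    : (S : Symbol) → Vector (Point 𝔉 d) (arity S) → Set r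
    ⟦⟧-resp : ∀ S → ⟦ S ⟧ Respects Pointwise (PointEq 𝔉 d)

  signature : Signature
  signature = record
    { FunSym = ⊥      ; funArity = λ ()
    ; RelSym = Symbol ; relArity = arity }

  structure : Structure signature c ℓ r
  structure = record
    { universe   = pointSetoid (underlyingField 𝔉) d
    ; ⟦fun⟧      = λ ()
    ; ⟦rel⟧      = ⟦_⟧
    ; ⟦fun⟧-cong = λ ()
    ; ⟦rel⟧-resp = ⟦⟧-resp
    }

  field
    basicRelation-definable : Definable structure (basicRelation 𝔉 d)

module _ {𝔉 : BaseField c ℓ} {d : ℕ} (𝒢 : CoordinateGeometry 𝔉 d r) where
  open CoordinateGeometry 𝒢

  FieldDefinable : Set (c ⊔ ℓ ⊔ r)
  FieldDefinable = ∀ S → DefinableOver 𝔉 ⟦ S ⟧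

  FFD : Set (c ⊔ ℓ ⊔ r)
  FFD = FieldDefinable × (∃[ k ] Symbol ↔ Fin k)

  Automorphism : (Point 𝔉 d → Point 𝔉 d) → Set (c ⊔ ℓ ⊔ r)
  Automorphism = IsAutomorphism structure

  AffineAutomorphism : (Point 𝔉 d → Point 𝔉 d) → Set (c ⊔ ℓ ⊔ r)
  AffineAutomorphism f =
    Automorphism f × IsAffineTransformation (underlyingField 𝔉) d f

  Concept : (Vector (Point 𝔉 d) n → Set s) → Set (c ⊔ ℓ ⊔ r ⊔ s)
  Concept = Definable structure

{-# OPTIONS --safe #-}
module Submission where

-- Collinearity (or betweenness) defines the relation q = p + λ(r - p), and from
-- it, when d ≥ 2 and there is a scalar t ∉ {0, 1}, translation of vectors: in the
-- plane of o, p, q the fourth vertex r of a parallelogram is characterised by pr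
-- missing oq and qr missing op, where r lies in that plane iff it is on a line
-- joining a point of op to a point of oq (at parameter t, say).  Hence every
-- frame (o, e) of F^d carries a copy of the field on its first axis, and the
-- coordinates with respect to (o, e) are definable from (o, e) in 𝒢.
--
-- By finiteness of the language, one formula then says of a frame that every
-- relation S of 𝒢 holds exactly of those points whose coordinates satisfy the
-- field formula for S, that is, that the affine map carrying the standard frame
-- to (o, e) is an automorphism of 𝒢.  If R is field-definable and invariant under
-- affine automorphisms, R holds of points p iff, for some such frame, the
-- coordinates of p satisfy the field formula for R; the standard frame is one.

open import Defs
open import Algebra.Bundles using (CommutativeRing; RawRing)
import Algebra.Properties.AbelianGroup
import Algebra.Properties.CommutativeSemigroup
import Algebra.Properties.Ring
import Algebra.Properties.Semiring.Mult.TCOptimised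
import Algebra.Properties.Semiring.Sum
import Algebra.Solver.Ring
open import Algebra.Solver.Ring.AlmostCommutativeRing
  using (fromCommutativeRing; _-Raw-AlmostCommutative⟶_)
open import Axiom.ExcludedMiddle using (ExcludedMiddle)
open import Data.Empty using (⊥)
open import Data.Fin.Base using (Fin; zero; suc; _↑ˡ_; _↑ʳ_; combine; remQuot)
  renaming (lift to lift-renaming)
open import Data.Fin.Patterns using (0F; 1F; 2F)
import Data.Fin.Properties as Fin
open import Data.Maybe.Base using (Maybe; just; nothing; maybe′)
open import Data.Nat.Base as ℕ using (ℕ; zero; suc; s≤s; z≤n)
import Data.Nat.Properties as ℕ
open import Data.Product.Base using (∃; ∃-syntax; _×_; _,_; proj₁; proj₂; uncurry)
open import Data.Product.Function.NonDependent.Propositional using (_×-⇔_)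
open import Data.Sum.Base using (_⊎_; inj₁; inj₂; [_,_]; [_,_]′)
open import Data.Sum.Function.Propositional using (_⊎-⇔_)
open import Data.Unit.Base using (⊤; tt)
open import Data.Vec.Functional using (Vector; []; _∷_; _++_; head; tail)
open import Data.Vec.Functional.Properties using (lookup-++ˡ; lookup-++ʳ)
open import Data.Vec.Functional.Relation.Binary.Pointwise using (Pointwise)
open import Function.Base using (_∘_; id; case_of_)
open import Function.Bundles using (_⇔_; mk⇔; Equivalence; _↔_; Inverse)
open import Function.Construct.Composition using (_⇔-∘_)
open import Function.Construct.Identity using (⇔-id)
open import Function.Construct.Symmetry using (⇔-sym)
open import Function.Definitions using (Injective; StrictlySurjective)
open import Function.Related.TypeIsomorphisms using (→-cong-⇔)
open import Function.Structures using (IsBijection)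
open import Level using (Level; _⊔_; 0ℓ; Lift; lift; lower) renaming (suc to lsuc)
open import Relation.Binary.Bundles using (Setoid)
open import Relation.Binary.Definitions using (_Respects_)
open import Relation.Binary.PropositionalEquality.Core as ≡ using (_≡_)
open import Relation.Binary.Structures using (IsTotalOrder)
open import Relation.Nullary.Decidable using (map′)
open import Relation.Nullary.Decidable.Core using (Dec; yes; no)
open import Relation.Nullary.Negation.Core using (¬_; contradiction)

open Equivalence using (to; from)

private
  variable
    c ℓ r s s′ : Level
    m n d : ℕ
    V W W′ : Set

-- The ring solver with integer coefficients, represented as differences of
-- natural numbers.
module IntegerSolver {c ℓ} (R : CommutativeRing c ℓ) where
  open CommutativeRing R
  open Algebra.Properties.AbelianGroup +-abelianGroup using (⁻¹-∙-comm; ⁻¹-involutive; ε⁻¹≈ε)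
  open Algebra.Properties.Ring ring using (-‿distribˡ-*; -‿distribʳ-*)
  open Algebra.Properties.Semiring.Mult.TCOptimised semiring using (×-homo-+; ×1-homo-*) renaming (_×_ to _·_)
  open import Relation.Binary.Reasoning.Setoid setoid
  open Algebra.Properties.CommutativeSemigroup +-commutativeSemigroup using (interchange)

  private
    -- The solver compares coefficients of normal forms syntactically, so
    -- they have to be kept in lowest terms.
    reduce : ℕ × ℕ → ℕ × ℕ
    reduce (a , b) = a ℕ.∸ b , b ℕ.∸ a

    differences : RawRing 0ℓ 0ℓ
    differences = record
      { Carrier = ℕ × ℕ
      ; _≈_ = _≡_
      ; _+_ = λ (a , b) (a′ , b′) → reduce (a ℕ.+ a′ , b ℕ.+ b′)
      ; _*_ = λ (a , b) (a′ , b′) → reduce (a ℕ.* a′ ℕ.+ b ℕ.* b′ , a ℕ.* b′ ℕ.+ b ℕ.* a′)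
      ; -_ = λ (a , b) → b , a
      ; 0# = 0 , 0
      ; 1# = 1 , 0
      }

    -- The split makes ⟦ 1 , 0 ⟧ reduce to 1#.
    ⟦_⟧ : ℕ × ℕ → Carrier
    ⟦ a , zero ⟧  = a · 1#
    ⟦ a , suc b ⟧ = a · 1# - suc b · 1#

    ⟦⟧-difference : ∀ a b → ⟦ a , b ⟧ ≈ a · 1# - b · 1#
    ⟦⟧-difference a zero    = sym (trans (+-congˡ ε⁻¹≈ε) (+-identityʳ _))
    ⟦⟧-difference a (suc b) = refl

    -- Adding `b′ · 1# - b′ · 1#` on the left and regrouping leaves only the sums that the
    -- hypothesis compares.
    cross : ∀ a b a′ b′ → a ℕ.+ b′ ≡ a′ ℕ.+ b → ⟦ a , b ⟧ ≈ ⟦ a′ , b′ ⟧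
    cross a b a′ b′ eq = begin
      ⟦ a , b ⟧                                      ≈⟨ ⟦⟧-difference a b ⟩
      a · 1# - b · 1#                                ≈⟨ +-identityʳ _ ⟨
      (a · 1# - b · 1#) + 0#                         ≈⟨ +-congˡ (-‿inverseʳ _) ⟨
      (a · 1# - b · 1#) + (b′ · 1# - b′ · 1#)        ≈⟨ interchange _ _ _ _ ⟩
      (a · 1# + b′ · 1#) + (- (b · 1#) - b′ · 1#)    ≈⟨ +-congʳ (×-homo-+ 1# a b′) ⟨
      (a ℕ.+ b′) · 1# + (- (b · 1#) - b′ · 1#)       ≡⟨ ≡.cong (λ k → k · 1# + (- (b · 1#) - b′ · 1#)) eq ⟩
      (a′ ℕ.+ b) · 1# + (- (b · 1#) - b′ · 1#)       ≈⟨ +-congʳ (×-homo-+ 1# a′ b) ⟩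
      (a′ · 1# + b · 1#) + (- (b · 1#) - b′ · 1#)    ≈⟨ +-congˡ (+-comm _ _) ⟩
      (a′ · 1# + b · 1#) + (- (b′ · 1#) - b · 1#)    ≈⟨ interchange _ _ _ _ ⟩
      (a′ · 1# - b′ · 1#) + (b · 1# - b · 1#)        ≈⟨ +-congˡ (-‿inverseʳ _) ⟩
      (a′ · 1# - b′ · 1#) + 0#                       ≈⟨ +-identityʳ _ ⟩
      a′ · 1# - b′ · 1#                              ≈⟨ ⟦⟧-difference a′ b′ ⟨
      ⟦ a′ , b′ ⟧                                    ∎

    -- Both sides are the maximum of `a` and `b`.
    ∸-balance : ∀ a b → a ℕ.∸ b ℕ.+ b ≡ a ℕ.+ (b ℕ.∸ a)
    ∸-balance zero    zero    = ≡.refl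
    ∸-balance zero    (suc b) = ≡.refl
    ∸-balance (suc a) zero    = ≡.refl
    ∸-balance (suc a) (suc b) = ≡.trans (ℕ.+-suc _ b) (≡.cong suc (∸-balance a b))

    ⟦⟧-reduce : ∀ a b → ⟦ reduce (a , b) ⟧ ≈ a · 1# - b · 1#
    ⟦⟧-reduce a b = trans (cross (a ℕ.∸ b) (b ℕ.∸ a) a b (∸-balance a b)) (⟦⟧-difference a b)

    +-homo : ∀ x y → ⟦ RawRing._+_ differences x y ⟧ ≈ ⟦ x ⟧ + ⟦ y ⟧
    +-homo (a , b) (a′ , b′) = begin
      ⟦ reduce (a ℕ.+ a′ , b ℕ.+ b′) ⟧
        ≈⟨ ⟦⟧-reduce (a ℕ.+ a′) (b ℕ.+ b′) ⟩
      (a ℕ.+ a′) · 1# - (b ℕ.+ b′) · 1#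
        ≈⟨ +-cong (×-homo-+ 1# a a′)
                  (trans (-‿cong (×-homo-+ 1# b b′)) (sym (⁻¹-∙-comm _ _))) ⟩
      (a · 1# + a′ · 1#) + (- (b · 1#) - b′ · 1#)
        ≈⟨ interchange _ _ _ _ ⟩
      (a · 1# - b · 1#) + (a′ · 1# - b′ · 1#)
        ≈⟨ +-cong (⟦⟧-difference a b) (⟦⟧-difference a′ b′) ⟨
      ⟦ a , b ⟧ + ⟦ a′ , b′ ⟧ ∎

    ·1-bilinear : ∀ a b a′ b′ →
      (a ℕ.* a′ ℕ.+ b ℕ.* b′) · 1# ≈ (a · 1#) * (a′ · 1#) + (b · 1#) * (b′ · 1#)
    ·1-bilinear a b a′ b′ =
      trans (×-homo-+ 1# (a ℕ.* a′) _) (+-cong (×1-homo-* a a′) (×1-homo-* b b′))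

    neg-neg : ∀ x y → (- x) * (- y) ≈ x * y
    neg-neg x y = trans (sym (-‿distribˡ-* x _))
      (trans (-‿cong (sym (-‿distribʳ-* x y))) (⁻¹-involutive _))

    *-homo : ∀ x y → ⟦ RawRing._*_ differences x y ⟧ ≈ ⟦ x ⟧ * ⟦ y ⟧
    *-homo (a , b) (a′ , b′) = begin
      ⟦ reduce (a ℕ.* a′ ℕ.+ b ℕ.* b′ , a ℕ.* b′ ℕ.+ b ℕ.* a′) ⟧
        ≈⟨ ⟦⟧-reduce (a ℕ.* a′ ℕ.+ b ℕ.* b′) (a ℕ.* b′ ℕ.+ b ℕ.* a′) ⟩
      (a ℕ.* a′ ℕ.+ b ℕ.* b′) · 1# - (a ℕ.* b′ ℕ.+ b ℕ.* a′) · 1#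
        ≈⟨ +-cong (·1-bilinear a b a′ b′) (-‿cong (·1-bilinear a b b′ a′)) ⟩
      (p * p′ + q * q′) - (p * q′ + q * p′)
        ≈⟨ +-cong (+-congˡ (sym (neg-neg q q′)))
             (trans (sym (⁻¹-∙-comm _ _)) (+-cong (-‿distribʳ-* p q′) (-‿distribˡ-* q p′))) ⟩
      (p * p′ + (- q) * (- q′)) + (p * (- q′) + (- q) * p′)
        ≈⟨ +-congˡ (+-comm _ _) ⟩
      (p * p′ + (- q) * (- q′)) + ((- q) * p′ + p * (- q′))
        ≈⟨ interchange _ _ _ _ ⟩
      (p * p′ + (- q) * p′) + ((- q) * (- q′) + p * (- q′))
        ≈⟨ +-cong (distribʳ p′ p (- q)) (trans (distribʳ (- q′) p (- q)) (+-comm _ _)) ⟨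
      (p - q) * p′ + (p - q) * (- q′)
        ≈⟨ distribˡ (p - q) p′ (- q′) ⟨
      (p - q) * (p′ - q′)
        ≈⟨ *-cong (⟦⟧-difference a b) (⟦⟧-difference a′ b′) ⟨
      ⟦ a , b ⟧ * ⟦ a′ , b′ ⟧ ∎
      where
      p = a · 1#
      q = b · 1#
      p′ = a′ · 1#
      q′ = b′ · 1#

    -‿homo : ∀ x → ⟦ proj₂ x , proj₁ x ⟧ ≈ - ⟦ x ⟧
    -‿homo (a , b) = begin
      ⟦ b , a ⟧                ≈⟨ ⟦⟧-difference b a ⟩
      b · 1# - a · 1#          ≈⟨ +-comm _ _ ⟩
      - (a · 1#) + b · 1#      ≈⟨ +-congˡ (⁻¹-involutive _) ⟨
      - (a · 1#) - - (b · 1#)  ≈⟨ ⁻¹-∙-comm _ _ ⟩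
      - (a · 1# - b · 1#)      ≈⟨ -‿cong (⟦⟧-difference a b) ⟨
      - ⟦ a , b ⟧              ∎

    morphism : differences -Raw-AlmostCommutative⟶ fromCommutativeRing R
    morphism = record
      { ⟦_⟧ = ⟦_⟧ ; +-homo = +-homo ; *-homo = *-homo ; -‿homo = -‿homo
      ; 0-homo = refl ; 1-homo = refl }

    _≟_ : ∀ x y → Maybe (⟦ x ⟧ ≈ ⟦ y ⟧)
    (a , b) ≟ (a′ , b′) with a ℕ.+ b′ ℕ.≟ a′ ℕ.+ b
    ... | yes eq = just (cross a b a′ b′ eq)
    ... | no  _  = nothing

  open Algebra.Solver.Ring differences (fromCommutativeRing R) morphism _≟_ public
    using (Polynomial; con; solve; _:=_; _:+_; _:*_; _:-_; :-_)

  :0 :1 : ∀ {n} → Polynomial n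
  :0 = con (0 , 0)
  :1 = con (1 , 0)

-- Equivalences, renaming of variables and invariance under automorphisms.

infixr 4 _⨾_
_⨾_ : {A : Set s} {B : Set s′} {C : Set r} → A ⇔ B → B ⇔ C → A ⇔ C
A⇔B ⨾ B⇔C = B⇔C ⇔-∘ A⇔B

∃-⇔ : ∀ {a b d} {A : Set a} {B : A → Set b} {D : A → Set d} →
      (∀ x → B x ⇔ D x) → ∃ B ⇔ ∃ D
∃-⇔ f = mk⇔ (λ (x , y) → x , to (f x) y) (λ (x , y) → x , from (f x) y)

∀-⇔ : ∀ {a b d} {A : Set a} {B : A → Set b} {D : A → Set d} →
      (∀ x → B x ⇔ D x) → (∀ x → B x) ⇔ (∀ x → D x)
∀-⇔ f = mk⇔ (λ h x → to (f x) (h x)) (λ h x → from (f x) (h x))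

Lift-⇔ : {A : Set s} → A ⇔ Lift r A
Lift-⇔ = mk⇔ lift lower

module _ {S : Signature} where
  rename-term : (Fin m → Fin n) → Term S m → Term S n
  rename-term f (var i)    = var (f i)
  rename-term f (fun g ts) = fun g (λ i → rename-term f (ts i))

  rename : (Fin m → Fin n) → Formula S m → Formula S n
  rename f (t ≐ u)    = rename-term f t ≐ rename-term f u
  rename f (rel R ts) = rel R (λ i → rename-term f (ts i))
  rename f ⊥̇          = ⊥̇
  rename f (φ ∧̇ ψ)    = rename f φ ∧̇ rename f ψ
  rename f (φ ∨̇ ψ)    = rename f φ ∨̇ rename f ψ
  rename f (φ ⇒̇ ψ)    = rename f φ ⇒̇ rename f ψ
  rename f (∀̇ φ)      = ∀̇ rename (lift-renaming 1 f) φ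
  rename f (∃̇ φ)      = ∃̇ rename (lift-renaming 1 f) φ

module Definability {S : Signature} (𝔐 : Structure S c ℓ r) where
  open Structure 𝔐 public
  open Setoid universe public using (refl; sym; trans; reflexive)

  module _ {h : Carrier → Carrier} (h-auto : IsAutomorphism 𝔐 h) where
    open IsAutomorphism h-auto
    open IsBijection isBijection

    rename-eval : (f : Fin m → Fin n) {σ : Vector Carrier m} {ρ : Vector Carrier n} →
                  (∀ i → h (σ i) ≈ ρ (f i)) →
                  ∀ t → h (eval 𝔐 σ t) ≈ eval 𝔐 ρ (rename-term f t)
    rename-eval f σ~ρ (var i)    = σ~ρ i
    rename-eval f σ~ρ (fun g ts) = trans (preserves-fun g _)
      (⟦fun⟧-cong g (λ i → rename-eval f σ~ρ (ts i)))

    -- One induction for two facts: `h = id` gives the effect of renaming, `f = id` the invariance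
    -- of satisfaction under automorphisms. Equations use injectivity of `h`, quantifiers its
    -- surjectivity.
    rename-⊨ : (f : Fin m → Fin n) {σ : Vector Carrier m} {ρ : Vector Carrier n} →
               (∀ i → h (σ i) ≈ ρ (f i)) →
               ∀ φ → (_⊨_ 𝔐 σ φ) ⇔ (_⊨_ 𝔐 ρ (rename f φ))
    rename-⊨ f σ~ρ (t ≐ u) = mk⇔
      (λ (lift eq) → lift (trans (sym (E t)) (trans (cong eq) (E u))))
      (λ (lift eq) → lift (injective (trans (E t) (trans eq (sym (E u))))))
      where E = rename-eval f σ~ρ
    rename-⊨ f σ~ρ (rel R ts) =
      ⇔-sym Lift-⇔ ⨾ preserves-rel R _
      ⨾ mk⇔ (⟦rel⟧-resp R E) (⟦rel⟧-resp R (λ i → sym (E i))) ⨾ Lift-⇔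
      where E = λ i → rename-eval f σ~ρ (ts i)
    rename-⊨ f σ~ρ ⊥̇       = ⇔-id _
    rename-⊨ f σ~ρ (φ ∧̇ ψ) = rename-⊨ f σ~ρ φ ×-⇔ rename-⊨ f σ~ρ ψ
    rename-⊨ f σ~ρ (φ ∨̇ ψ) = rename-⊨ f σ~ρ φ ⊎-⇔ rename-⊨ f σ~ρ ψ
    rename-⊨ f σ~ρ (φ ⇒̇ ψ) = →-cong-⇔ (rename-⊨ f σ~ρ φ) (rename-⊨ f σ~ρ ψ)
    rename-⊨ f {σ} {ρ} σ~ρ (∀̇ φ) = mk⇔
      (λ p y → let x , hx≈ = strictlySurjective y in to (body x y hx≈) (p x))
      (λ p x → from (body x (h x) refl) (p (h x)))
      where
      body : ∀ x y → h x ≈ y → (_⊨_ 𝔐 (x ∷ σ) φ) ⇔ (_⊨_ 𝔐 (y ∷ ρ) (rename (lift-renaming 1 f) φ))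
      body x y hx≈y = rename-⊨ (lift-renaming 1 f) (λ { zero → hx≈y ; (suc i) → σ~ρ i }) φ
    rename-⊨ f {σ} {ρ} σ~ρ (∃̇ φ) = mk⇔
      (λ (x , p) → h x , to (body x (h x) refl) p)
      (λ (y , p) → let x , hx≈ = strictlySurjective y in x , from (body x y hx≈) p)
      where
      body : ∀ x y → h x ≈ y → (_⊨_ 𝔐 (x ∷ σ) φ) ⇔ (_⊨_ 𝔐 (y ∷ ρ) (rename (lift-renaming 1 f) φ))
      body x y hx≈y = rename-⊨ (lift-renaming 1 f) (λ { zero → hx≈y ; (suc i) → σ~ρ i }) φ

  id-automorphism : IsAutomorphism 𝔐 id
  id-automorphism = record
    { isBijection = record
        { isInjection = record
            { isCongruent = record
                { cong = id
                ; isEquivalence₁ = Setoid.isEquivalence universe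
                ; isEquivalence₂ = Setoid.isEquivalence universe }
            ; injective = id }
        ; surjective = λ y → y , id }
    ; preserves-fun = λ _ _ → refl
    ; preserves-rel = λ _ _ → ⇔-id _ }

  -- Both assignments are compared with `ρ` satisfying `rename id φ`, a formula that is not
  -- literally `φ`.
  ⊨-cong : {σ ρ : Vector Carrier n} → (∀ i → σ i ≈ ρ i) →
           ∀ φ → (_⊨_ 𝔐 σ φ) ⇔ (_⊨_ 𝔐 ρ φ)
  ⊨-cong {ρ = ρ} σ≈ρ φ = rename-⊨ id-automorphism id σ≈ρ φ
    ⨾ ⇔-sym (rename-⊨ id-automorphism id (λ i → refl {ρ i}) φ)

  Definable-closed : {R : Vector Carrier n → Set s} → Definable 𝔐 R →
                     ∀ h → IsAutomorphism 𝔐 h → ClosedUnder h R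
  Definable-closed (φ , R⇔φ) h h-auto xs Rxs =
    from (R⇔φ (h ∘ xs)) (from (rename-⊨ id-automorphism id (λ _ → refl) φ)
      (to (rename-⊨ h-auto id (λ _ → refl) φ) (to (R⇔φ xs) Rxs)))

  -- Closure properties of definable predicates.

  -- Predicates on assignments to an arbitrary set V of variable names are
  -- definable when they are so for every numbering of the names; relating σ
  -- and ρ only up to ≈ avoids function extensionality.
  Def : {V : Set} → ((V → Carrier) → Set s) → Set (c ⊔ ℓ ⊔ r ⊔ s)
  Def {V = V} P = ∀ {n} (f : V → Fin n) → ∃[ φ ]
    (∀ σ (ρ : Vector Carrier n) → (∀ v → σ v ≈ ρ (f v)) → P σ ⇔ (_⊨_ 𝔐 ρ φ))

  private
    variable
      P : (V → Carrier) → Set s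
      Q : (V → Carrier) → Set s′

  Definable⇒Def : {R : Vector Carrier n → Set s} → Definable 𝔐 R → Def R
  Definable⇒Def (φ , R⇔φ) f = rename f φ , λ σ ρ σ~ρ →
    R⇔φ σ ⨾ rename-⊨ id-automorphism f σ~ρ φ

  Def⇒Definable : {R : Vector Carrier n → Set s} → Def R → Definable 𝔐 R
  Def⇒Definable R-def = let φ , R⇔φ = R-def id in φ , λ xs → R⇔φ xs xs (λ _ → refl)

  def-rel : ∀ R (x : Fin (Signature.relArity S R) → V) → Def (λ σ → ⟦rel⟧ R (λ i → σ (x i)))
  def-rel R x f = rel R (λ i → var (f (x i))) , λ σ ρ σ~ρ →
    mk⇔ (⟦rel⟧-resp R (λ i → σ~ρ (x i))) (⟦rel⟧-resp R (λ i → sym (σ~ρ (x i)))) ⨾ Lift-⇔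

  def-≈ : (x y : V) → Def (λ σ → σ x ≈ σ y)
  def-≈ x y f = (var (f x) ≐ var (f y)) , λ σ ρ σ~ρ → mk⇔
    (λ eq → lift (trans (sym (σ~ρ x)) (trans eq (σ~ρ y))))
    (λ (lift eq) → trans (σ~ρ x) (trans eq (sym (σ~ρ y))))

  def-⊥ : Def {V = V} (λ _ → ⊥)
  def-⊥ f = ⊥̇ , λ σ ρ σ~ρ → Lift-⇔

  def-⊤ : Def {V = V} (λ _ → ⊤)
  def-⊤ f = (⊥̇ ⇒̇ ⊥̇) , λ σ ρ σ~ρ → mk⇔ (λ _ → id) (λ _ → tt)

  def-reindex : (g : V → W) → Def P → Def (λ σ → P (σ ∘ g))
  def-reindex g P-def f = let φ , P⇔φ = P-def (f ∘ g) in
    φ , λ σ ρ σ~ρ → P⇔φ (σ ∘ g) ρ (σ~ρ ∘ g)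

  def-⇔ : (∀ σ → P σ ⇔ Q σ) → Def P → Def Q
  def-⇔ P⇔Q P-def f = let φ , P⇔φ = P-def f in
    φ , λ σ ρ σ~ρ → ⇔-sym (P⇔Q σ) ⨾ P⇔φ σ ρ σ~ρ

  infixr 6 _def-×_
  _def-×_ : Def P → Def Q → Def (λ σ → P σ × Q σ)
  (P-def def-× Q-def) f = let φ , P⇔φ = P-def f ; ψ , Q⇔ψ = Q-def f in
    (φ ∧̇ ψ) , λ σ ρ σ~ρ → P⇔φ σ ρ σ~ρ ×-⇔ Q⇔ψ σ ρ σ~ρ

  infixr 5 _def-⊎_
  _def-⊎_ : Def P → Def Q → Def (λ σ → P σ ⊎ Q σ)
  (P-def def-⊎ Q-def) f = let φ , P⇔φ = P-def f ; ψ , Q⇔ψ = Q-def f in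
    (φ ∨̇ ψ) , λ σ ρ σ~ρ → P⇔φ σ ρ σ~ρ ⊎-⇔ Q⇔ψ σ ρ σ~ρ

  infixr 4 _def-→_
  _def-→_ : Def P → Def Q → Def (λ σ → P σ → Q σ)
  (P-def def-→ Q-def) f = let φ , P⇔φ = P-def f ; ψ , Q⇔ψ = Q-def f in
    (φ ⇒̇ ψ) , λ σ ρ σ~ρ → →-cong-⇔ (P⇔φ σ ρ σ~ρ) (Q⇔ψ σ ρ σ~ρ)

  def-¬ : Def P → Def (λ σ → ¬ P σ)
  def-¬ P-def = P-def def-→ def-⊥

  private
    -- The name `nothing` stands for the bound variable, which formulas number zero.
    extend : (V → Fin n) → Maybe V → Fin (suc n)
    extend f = maybe′ (suc ∘ f) zero

    extend-~ : (f : V → Fin n) {σ : V → Carrier} {ρ : Vector Carrier n} →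
               (∀ v → σ v ≈ ρ (f v)) →
               ∀ x v → maybe′ σ x v ≈ (x ∷ ρ) (extend f v)
    extend-~ f σ~ρ x nothing  = refl
    extend-~ f σ~ρ x (just v) = σ~ρ v

  def-∃ : {P : (Maybe V → Carrier) → Set s} → Def P → Def (λ σ → ∃[ x ] P (maybe′ σ x))
  def-∃ P-def f = let φ , P⇔φ = P-def (extend f) in
    (∃̇ φ) , λ σ ρ σ~ρ → ∃-⇔ (λ x → P⇔φ (maybe′ σ x) (x ∷ ρ) (extend-~ f σ~ρ x))

  def-∀ : {P : (Maybe V → Carrier) → Set s} → Def P → Def (λ σ → ∀ x → P (maybe′ σ x))
  def-∀ P-def f = let φ , P⇔φ = P-def (extend f) in
    (∀̇ φ) , λ σ ρ σ~ρ → ∀-⇔ (λ x → P⇔φ (maybe′ σ x) (x ∷ ρ) (extend-~ f σ~ρ x))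

  def-⋀ : (m : ℕ) {P : Fin m → (V → Carrier) → Set s} →
          (∀ i → Def (P i)) → Def (λ σ → ∀ i → P i σ)
  def-⋀ zero    P-def = def-⇔ (λ σ → mk⇔ (λ _ ()) (λ _ → tt)) def-⊤
  def-⋀ (suc m) P-def =
    def-⇔ (λ σ → mk⇔ (λ (p , ps) → λ { zero → p ; (suc i) → ps i })
                     (λ ps → ps zero , ps ∘ suc))
          (P-def zero def-× def-⋀ m (P-def ∘ suc))

  private
    -- The innermost quantifier binds index zero, so the head of the block is chosen last.
    ∃̇ⁿ ∀̇ⁿ : ∀ m → Formula S (m ℕ.+ n) → Formula S n
    ∃̇ⁿ zero    φ = φ
    ∃̇ⁿ (suc m) φ = ∃̇ⁿ m (∃̇ φ)
    ∀̇ⁿ zero    φ = φ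
    ∀̇ⁿ (suc m) φ = ∀̇ⁿ m (∀̇ φ)

    -- Expresses that `τ` is `xs ++ ρ` up to `≈`. With `τ` left free, the induction can pass to
    -- `x ∷ τ`, which agrees with `(x ∷ xs) ++ ρ` only pointwise.
    Splits : ∀ m → Vector Carrier (m ℕ.+ n) → Vector Carrier m → Vector Carrier n → Set ℓ
    Splits {n} m τ xs ρ = (∀ i → τ (i ↑ˡ n) ≈ xs i) × (∀ j → τ (m ↑ʳ j) ≈ ρ j)

    ++-splits : (xs : Vector Carrier m) (ρ : Vector Carrier n) → Splits m (xs ++ ρ) xs ρ
    ++-splits xs ρ = (λ i → reflexive (lookup-++ˡ xs ρ i)) , (λ j → reflexive (lookup-++ʳ xs ρ j))

    ∷-splits : ∀ x {τ} {xs : Vector Carrier m} {ρ : Vector Carrier n} →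
               Splits m τ xs ρ → Splits (suc m) (x ∷ τ) (x ∷ xs) ρ
    ∷-splits x (l , r) = (λ { zero → refl ; (suc i) → l i }) , r

    ∷-splits′ : {τ : Vector Carrier (m ℕ.+ n)} (xs : Vector Carrier (suc m)) {ρ : Vector Carrier n} →
                Splits m τ (tail xs) ρ → Splits (suc m) (head xs ∷ τ) xs ρ
    ∷-splits′ xs (l , r) = (λ { zero → refl ; (suc i) → l i }) , r

    ∃ⁿ-⇔ : ∀ m {ρ : Vector Carrier n} {Q : Vector Carrier m → Set s} {φ : Formula S (m ℕ.+ n)} →
           (∀ xs τ → Splits m τ xs ρ → Q xs ⇔ (_⊨_ 𝔐 τ φ)) →
           ∃ Q ⇔ (_⊨_ 𝔐 ρ (∃̇ⁿ m φ))
    ∃ⁿ-⇔ zero {ρ} Q⇔φ = mk⇔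
      (λ (xs , q) → to (Q⇔φ xs ρ ((λ ()) , λ _ → refl)) q)
      (λ p → [] , from (Q⇔φ [] ρ ((λ ()) , λ _ → refl)) p)
    ∃ⁿ-⇔ (suc m) {ρ} {Q} {φ} Q⇔φ =
      -- `xs` and `head xs ∷ tail xs` agree only pointwise, and `Q` is not known to respect this;
      -- the passage goes through `φ`, evaluated at one and the same assignment.
      mk⇔ (λ (xs , q) → tail xs , head xs ,
             let τ = tail xs ++ ρ ; split = ++-splits (tail xs) ρ in
             from (Q⇔φ _ (head xs ∷ τ) (∷-splits (head xs) split))
               (to (Q⇔φ xs (head xs ∷ τ) (∷-splits′ xs split)) q))
          (λ (xs , x , q) → x ∷ xs , q)
      ⨾ ∃ⁿ-⇔ m {Q = λ xs → ∃[ x ] Q (x ∷ xs)}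
          (λ xs τ split → ∃-⇔ (λ x → Q⇔φ (x ∷ xs) (x ∷ τ) (∷-splits x split)))

    ∀ⁿ-⇔ : ∀ m {ρ : Vector Carrier n} {Q : Vector Carrier m → Set s} {φ : Formula S (m ℕ.+ n)} →
           (∀ xs τ → Splits m τ xs ρ → Q xs ⇔ (_⊨_ 𝔐 τ φ)) →
           (∀ xs → Q xs) ⇔ (_⊨_ 𝔐 ρ (∀̇ⁿ m φ))
    ∀ⁿ-⇔ zero {ρ} Q⇔φ = mk⇔
      (λ q → to (Q⇔φ [] ρ ((λ ()) , λ _ → refl)) (q []))
      (λ p xs → from (Q⇔φ xs ρ ((λ ()) , λ _ → refl)) p)
    ∀ⁿ-⇔ (suc m) {ρ} {Q} {φ} Q⇔φ =
      mk⇔ (λ q xs x → q (x ∷ xs))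
          (λ q xs →
             let τ = tail xs ++ ρ ; split = ++-splits (tail xs) ρ in
             from (Q⇔φ xs (head xs ∷ τ) (∷-splits′ xs split))
               (to (Q⇔φ _ (head xs ∷ τ) (∷-splits (head xs) split)) (q (tail xs) (head xs))))
      ⨾ ∀ⁿ-⇔ m {Q = λ xs → ∀ x → Q (x ∷ xs)}
          (λ xs τ split → ∀-⇔ (λ x → Q⇔φ (x ∷ xs) (x ∷ τ) (∷-splits x split)))

    extendⁿ : ∀ m → (V → Fin n) → Fin m ⊎ V → Fin (m ℕ.+ n)
    extendⁿ {n = n} m f = [ _↑ˡ n , (m ↑ʳ_) ∘ f ]

    extendⁿ-~ : ∀ m (f : V → Fin n) {σ : V → Carrier} {ρ : Vector Carrier n} →
                (∀ v → σ v ≈ ρ (f v)) → ∀ xs τ → Splits m τ xs ρ →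
                ∀ v → [ xs , σ ] v ≈ τ (extendⁿ m f v)
    extendⁿ-~ m f σ~ρ xs τ (l , r) (inj₁ i) = sym (l i)
    extendⁿ-~ m f σ~ρ xs τ (l , r) (inj₂ v) = trans (σ~ρ v) (sym (r (f v)))

  def-∃ⁿ : ∀ m {P : (Fin m ⊎ V → Carrier) → Set s} → Def P → Def (λ σ → ∃[ xs ] P [ xs , σ ])
  def-∃ⁿ m P-def f = let φ , P⇔φ = P-def (extendⁿ m f) in
    ∃̇ⁿ m φ , λ σ ρ σ~ρ → ∃ⁿ-⇔ m (λ xs τ split →
      P⇔φ [ xs , σ ] τ (extendⁿ-~ m f σ~ρ xs τ split))

  def-∀ⁿ : ∀ m {P : (Fin m ⊎ V → Carrier) → Set s} → Def P → Def (λ σ → ∀ xs → P [ xs , σ ])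
  def-∀ⁿ m P-def f = let φ , P⇔φ = P-def (extendⁿ m f) in
    ∀̇ⁿ m φ , λ σ ρ σ~ρ → ∀ⁿ-⇔ m (λ xs τ split →
      P⇔φ [ xs , σ ] τ (extendⁿ-~ m f σ~ρ xs τ split))

-- Field arithmetic.

lower-em : ∀ {a} b → ExcludedMiddle (a ⊔ b) → ExcludedMiddle a
lower-em b em = map′ lower lift (em {Lift b _})

module FieldProperties {c ℓ} (F : Field c ℓ) (em : ExcludedMiddle (c ⊔ ℓ)) where
  open Field F public
  open IntegerSolver commutativeRing public

  infix 4 _≟_
  _≟_ : ∀ x y → Dec (x ≈ y)
  x ≟ y = lower-em c em

  -- An equation follows from e : k ≈ l once x and y + w * (k - l) agree as polynomials.
  modulo : ∀ {x y k l} w → k ≈ l → x ≈ y + w * (k - l) → x ≈ y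
  modulo w k≈l eq = trans eq (trans (+-congˡ (trans (*-congˡ (trans (+-congʳ k≈l) (-‿inverseʳ _))) (zeroʳ w))) (+-identityʳ _))

  x-y≈0⇒x≈y : ∀ {x y} → x - y ≈ 0# → x ≈ y
  x-y≈0⇒x≈y {x} {y} e = modulo 1# e
    (solve 2 (λ x y → x := y :+ :1 :* ((x :- y) :- :0)) refl x y)

  x≉y⇒x-y≉0 : ∀ {x y} → ¬ x ≈ y → ¬ x - y ≈ 0#
  x≉y⇒x-y≉0 x≉y = x≉y ∘ x-y≈0⇒x≈y

  x*y≈0⇒y≈0 : ∀ {x y} → ¬ x ≈ 0# → x * y ≈ 0# → y ≈ 0#
  x*y≈0⇒y≈0 {x} {y} x≉0 xy≈0 with k , xk≈1 ← inverse x x≉0 =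
    modulo (- y) xk≈1 (modulo k xy≈0
      (solve 3 (λ x y k → y := :0 :+ (:- y) :* (x :* k :- :1) :+ k :* (x :* y :- :0)) refl x y k))

-- Lines, parallelograms and translation of vectors.

module AffineGeometry {c ℓ} (F : Field c ℓ) (em : ExcludedMiddle (c ⊔ ℓ)) (d : ℕ) where
  open FieldProperties F em public

  Pt : Set c
  Pt = Vector Carrier d

  infix 4 _≐ᵖ_
  _≐ᵖ_ : Pt → Pt → Set ℓ
  p ≐ᵖ q = ∀ i → p i ≈ q i

  _≟ᵖ_ : ∀ p q → Dec (p ≐ᵖ q)
  p ≟ᵖ q = lower-em c em

  Lin : Pt → Pt → Pt → Set (c ⊔ ℓ)
  Lin p q r = ∃[ a ] (∀ i → q i ≈ p i + a * (r i - p i))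

  Translate : Pt → Pt → Pt → Pt → Set ℓ
  Translate o q p r = ∀ i → r i ≈ p i + (q i - o i)

  Disjoint : Pt → Pt → Pt → Pt → Set (c ⊔ ℓ)
  Disjoint p r o q = ¬ (∃[ s ] Lin p s r × Lin o s q)

  Coplanar : Pt → Pt → Pt → Pt → Set (c ⊔ ℓ)
  Coplanar o q p r = ∃[ a ] ∃[ b ] Lin o a p × Lin o b q × Lin a r b

  -- o, q, r, p are the successive vertices of a nondegenerate parallelogram.
  Parallelogram : Pt → Pt → Pt → Pt → Set (c ⊔ ℓ)
  Parallelogram o q p r = ¬ (q ≐ᵖ o) × ¬ Lin o p q × Coplanar o q p r
                        × Disjoint p r o q × Disjoint q r o p

  -- Along the line `pr` the coefficient of `p - o` runs from 1 to `x`. If `x` is not 1, it vanishes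
  -- at the parameter `1/(1 - x)`, and there `pr` meets `oq`.
  coordinate≈1 : ∀ {o p q r} x y → (∀ i → r i ≈ o i + x * (p i - o i) + y * (q i - o i)) →
                 Disjoint p r o q → x ≈ 1#
  coordinate≈1 {o} {p} {q} {r} x y r≈ disjoint with x ≟ 1#
  ... | yes x≈1 = x≈1
  ... | no  x≉1 with k , e ← inverse (1# - x) (x≉y⇒x-y≉0 (x≉1 ∘ sym)) = contradiction
    ( (λ i → o i + k * y * (q i - o i))
    , (k , λ i → modulo (p i - o i) e (modulo (- k) (r≈ i)
        (solve 7 (λ o p q r x y k →
           o :+ k :* y :* (q :- o) :=
           p :+ k :* (r :- p) :+ (p :- o) :* ((:1 :- x) :* k :- :1)
             :+ (:- k) :* (r :- (o :+ x :* (p :- o) :+ y :* (q :- o))))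
          refl (o i) (p i) (q i) (r i) x y k)))
    , (k * y , λ i → refl) )
    disjoint

  -- Coplanarity writes `r` as `o + x (p - o) + y (q - o)`; each of the two disjointness conditions
  -- forces one coefficient to be 1.
  Parallelogram⇒Translate : ∀ {o q p r} → Parallelogram o q p r → Translate o q p r
  Parallelogram⇒Translate {o} {q} {p} {r}
    (_ , _ , (a , b , (α , a≈) , (β , b≈) , (l , r≈)) , disjoint₁ , disjoint₂) i =
    modulo (p i - o i) x≈1 (modulo (q i - o i) y≈1 (trans (r≈′ i)
      (solve 5 (λ o p q x y →
         o :+ x :* (p :- o) :+ y :* (q :- o) :=
         p :+ (q :- o) :+ (p :- o) :* (x :- :1) :+ (q :- o) :* (y :- :1))
        refl (o i) (p i) (q i) x y)))
    where
    x = (1# - l) * α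
    y = l * β
    r≈′ : ∀ i → r i ≈ o i + x * (p i - o i) + y * (q i - o i)
    r≈′ i = modulo (1# - l) (a≈ i) (modulo l (b≈ i) (trans (r≈ i)
      (solve 8 (λ o p q a b α β l →
         a :+ l :* (b :- a) :=
         o :+ ((:1 :- l) :* α) :* (p :- o) :+ (l :* β) :* (q :- o)
           :+ (:1 :- l) :* (a :- (o :+ α :* (p :- o))) :+ l :* (b :- (o :+ β :* (q :- o))))
        refl (o i) (p i) (q i) (a i) (b i) α β l)))
    x≈1 = coordinate≈1 x y r≈′ disjoint₁
    y≈1 = coordinate≈1 y x
      (λ i → trans (r≈′ i) (solve 3 (λ o u v → o :+ u :+ v := o :+ v :+ u) refl _ _ _)) disjoint₂

  module _ (t : Carrier) (t≉0 : ¬ t ≈ 0#) (t≉1 : ¬ t ≈ 1#) where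

    Translate⇒Parallelogram : ∀ {o q p r} → ¬ (q ≐ᵖ o) → ¬ Lin o p q →
                              Translate o q p r → Parallelogram o q p r
    Translate⇒Parallelogram {o} {q} {p} {r} q≉o p∉oq r≈
      with k , k-inv ← inverse (1# - t) (x≉y⇒x-y≉0 (t≉1 ∘ sym))
         | l , l-inv ← inverse t t≉0 =
      q≉o , p∉oq
      -- Stretching by `1/(1 - t)` on `op` and by `1/t` on `oq` makes `r` the point at parameter `t`
      -- between the two.
      , ( (λ i → o i + k * (p i - o i)) , (λ i → o i + l * (q i - o i))
        , (k , λ i → refl) , (l , λ i → refl)
        , (t , λ i → modulo (- (p i - o i)) k-inv (modulo (- (q i - o i)) l-inv (trans (r≈ i)
            (solve 6 (λ o p q k l t →
               p :+ (q :- o) :=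
               (o :+ k :* (p :- o)) :+ t :* ((o :+ l :* (q :- o)) :- (o :+ k :* (p :- o)))
                 :+ (:- (p :- o)) :* ((:1 :- t) :* k :- :1)
                 :+ (:- (q :- o)) :* (t :* l :- :1))
              refl (o i) (p i) (q i) k l t)))) )
      -- `pr` has the direction of `oq`, so a common point would put `p` on `oq`.
      , (λ (s , (l , s≈) , (m , s≈′)) → p∉oq (m - l , λ i →
          modulo 1# (s≈′ i) (modulo (- 1#) (s≈ i) (modulo (- l) (r≈ i)
            (solve 7 (λ o p q r s l m →
               p := o :+ (m :- l) :* (q :- o)
                 :+ :1 :* (s :- (o :+ m :* (q :- o)))
                 :+ (:- :1) :* (s :- (p :+ l :* (r :- p)))
                 :+ (:- l) :* (r :- (p :+ (q :- o))))
              refl (o i) (p i) (q i) (r i) (s i) l m)))))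
      , (λ (s , (l , s≈) , (m , s≈′)) →
          let q≈ : ∀ i → q i ≈ o i + (m - l) * (p i - o i)
              q≈ i = modulo 1# (s≈′ i) (modulo (- 1#) (s≈ i) (modulo (- l) (r≈ i)
                (solve 7 (λ o p q r s l m →
                   q := o :+ (m :- l) :* (p :- o)
                     :+ :1 :* (s :- (o :+ m :* (p :- o)))
                     :+ (:- :1) :* (s :- (q :+ l :* (r :- q)))
                     :+ (:- l) :* (r :- (p :+ (q :- o))))
                  refl (o i) (p i) (q i) (r i) (s i) l m)))
          -- Now `q` lies on `op`: at parameter 0 it equals `o`, and otherwise inverting the
          -- parameter puts `p` on `oq`.
          in case (m - l) ≟ 0# of λ
            { (yes e) → q≉o (λ i → modulo (p i - o i) e (trans (q≈ i)
                (solve 3 (λ o p n → o :+ n :* (p :- o) := o :+ (p :- o) :* (n :- :0))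
                  refl (o i) (p i) (m - l))))
            ; (no ne) → let k , k-inv = inverse (m - l) ne in p∉oq (k , λ i →
                modulo (- (p i - o i)) k-inv (modulo (- k) (q≈ i)
                  (solve 5 (λ o p q n k →
                     p := o :+ k :* (q :- o) :+ (:- (p :- o)) :* (n :* k :- :1)
                       :+ (:- k) :* (q :- (o :+ n :* (p :- o))))
                    refl (o i) (p i) (q i) (m - l) k))) })

    -- Translating along the line oq itself takes two parallelograms.  Allowing two
    -- of them for every p avoids a further case: in a plane, a line off oq and p
    -- exists because there is a scalar t other than 0 and 1.
    TranslateByLin : Pt → Pt → Pt → Pt → Set (c ⊔ ℓ)
    TranslateByLin o q p r =
      ((q ≐ᵖ o) × (r ≐ᵖ p))
      ⊎ (∃[ x ] ∃[ y ] Parallelogram o q x y × Parallelogram x y p r)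

    TranslateByLin⇒Translate : ∀ {o q p r} → TranslateByLin o q p r → Translate o q p r
    TranslateByLin⇒Translate {o} {q} {p} {r} (inj₁ (q≈o , r≈p)) i =
      modulo (- 1#) (q≈o i) (modulo 1# (r≈p i)
        (solve 4 (λ o q p r →
           r := p :+ (q :- o) :+ (:- :1) :* (q :- o) :+ :1 :* (r :- p))
          refl (o i) (q i) (p i) (r i)))
    TranslateByLin⇒Translate {o} {q} {p} {r} (inj₂ (x , y , oqxy , xypr)) i =
      modulo 1# (Parallelogram⇒Translate oqxy i) (modulo 1# (Parallelogram⇒Translate xypr i)
        (solve 6 (λ o q p r x y →
           r := p :+ (q :- o) :+ :1 :* (y :- (x :+ (q :- o))) :+ :1 :* (r :- (p :+ (y :- x))))
          refl (o i) (q i) (p i) (r i) (x i) (y i)))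

    -- The vector is carried from `oq` to `xy` and then to `pr`. Both parallelograms are
    -- nondegenerate if `x` is off `oq` and `p` is off the parallel to `oq` through `x`.
    translate-twice : ∀ {o q p r} x → ¬ (q ≐ᵖ o) → ¬ Lin o x q →
      (∀ l → ¬ (∀ i → p i ≈ x i + l * (q i - o i))) →
      Translate o q p r → TranslateByLin o q p r
    translate-twice {o} {q} {p} {r} x q≉o x∉oq p∉x r≈ = inj₂ (x , y
      , Translate⇒Parallelogram q≉o x∉oq (λ i → refl)
      , Translate⇒Parallelogram y≉x p∉xy (λ i → trans (r≈ i)
          (solve 4 (λ o q p x → p :+ (q :- o) := p :+ ((x :+ (q :- o)) :- x))
            refl (o i) (q i) (p i) (x i))))
      where
      y : Pt
      y i = x i + (q i - o i)
      y≉x : ¬ (y ≐ᵖ x)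
      y≉x y≈x = q≉o (λ i → modulo 1# (y≈x i)
        (solve 3 (λ o q x → q := o :+ :1 :* ((x :+ (q :- o)) :- x)) refl (o i) (q i) (x i)))
      p∉xy : ¬ Lin x p y
      p∉xy (l , p≈) = p∉x l (λ i → trans (p≈ i)
        (solve 4 (λ o q x l → x :+ l :* ((x :+ (q :- o)) :- x) := x :+ l :* (q :- o))
          refl (o i) (q i) (x i) l))

    Translate⇒TranslateByLin : (∀ o q → ∃[ x ] ¬ Lin o x q) →
      ∀ {o q p r} → Translate o q p r → TranslateByLin o q p r
    Translate⇒TranslateByLin off-line {o} {q} {p} {r} r≈ with q ≟ᵖ o | em {Lin o p q}
    ... | yes q≈o | _ = inj₁ (q≈o , λ i → modulo 1# (q≈o i) (trans (r≈ i)
            (solve 3 (λ o q p → p :+ (q :- o) := p :+ :1 :* (q :- o)) refl (o i) (q i) (p i))))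
    -- For `p` on `oq` any `x` off `oq` will do: `p` on the parallel through `x` would put `x` on
    -- `oq`.
    ... | no q≉o | yes (k , p≈) with x , x∉oq ← off-line o q =
      translate-twice x q≉o x∉oq (λ l p≈′ → x∉oq (k - l , λ i →
        modulo 1# (p≈ i) (modulo (- 1#) (p≈′ i)
          (solve 6 (λ o q p x k l →
             x := o :+ (k :- l) :* (q :- o)
               :+ :1 :* (p :- (o :+ k :* (q :- o))) :+ (:- :1) :* (p :- (x :+ l :* (q :- o))))
            refl (o i) (q i) (p i) (x i) k l)))) r≈
    Translate⇒TranslateByLin off-line {o} {q} {p} {r} r≈ | no q≉o | no p∉oq
      with k , k-inv ← inverse t t≉0
         | m , m-inv ← inverse (1# - t) (x≉y⇒x-y≉0 (t≉1 ∘ sym)) =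
      -- For `p` off `oq` the point at parameter `t` on `op` is chosen: it is off `oq` as `t` is not
      -- 0, and its parallel misses `p` as `t` is not 1.
      translate-twice (λ i → o i + t * (p i - o i)) q≉o
        (λ (l , x≈) → p∉oq (k * l , λ i →
          modulo (- (p i - o i)) k-inv (modulo k (x≈ i)
            (solve 6 (λ o q p k l t →
               p := o :+ (k :* l) :* (q :- o) :+ (:- (p :- o)) :* (t :* k :- :1)
                 :+ k :* (o :+ t :* (p :- o) :- (o :+ l :* (q :- o))))
              refl (o i) (q i) (p i) k l t))))
        (λ l p≈ → p∉oq (m * l , λ i →
          modulo (- (p i - o i)) m-inv (modulo m (p≈ i)
            (solve 6 (λ o q p m l t →
               p := o :+ (m :* l) :* (q :- o) :+ (:- (p :- o)) :* ((:1 :- t) :* m :- :1)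
                 :+ m :* (p :- (o :+ t :* (p :- o) :+ l :* (q :- o))))
              refl (o i) (q i) (p i) m l t))))
        r≈

-- Arithmetic of points on an axis and coordinates in a frame.

module Coordinates {c ℓ} (F : Field c ℓ) (em : ExcludedMiddle (c ⊔ ℓ)) (d : ℕ) where
  open AffineGeometry F em d public
  open Algebra.Properties.Semiring.Sum semiring using (sum; sum-cong-≋; ∑-distrib-+; *-distribˡ-sum) public

  scale : Pt → Pt → Carrier → Pt
  scale o e x i = o i + x * (e i - o i)

  -- Phrased by `Translate` and `Lin`, which are definable in the geometry; `a` and `b` may
  -- coincide.
  Parallel : Pt → Pt → Pt → Pt → Set (c ⊔ ℓ)
  Parallel a b p q = ∃[ u ] Translate a b p u × Lin p u q

  Parallel-⇔ : ∀ {a b p q} → Parallel a b p q ⇔ (∃[ l ] ∀ i → b i - a i ≈ l * (q i - p i))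
  Parallel-⇔ {a} {b} {p} {q} = mk⇔
    (λ (u , u≈ , (l , u≈′)) → l , λ i → modulo (- 1#) (u≈ i) (modulo 1# (u≈′ i)
      (solve 6 (λ a b p q u l →
         b :- a := l :* (q :- p) :+ (:- :1) :* (u :- (p :+ (b :- a)))
           :+ :1 :* (u :- (p :+ l :* (q :- p))))
        refl (a i) (b i) (p i) (q i) (u i) l)))
    (λ (l , e) → (λ i → p i + (b i - a i)) , (λ i → refl) , l , λ i → +-congˡ (e i))

  -- Intercept theorem: q ∈ of is the image of p ∈ oe under projection along ef.
  Transfer : Pt → Pt → Pt → Pt → Pt → Set (c ⊔ ℓ)
  Transfer o e f p q = Lin o q f × Parallel p q e f

  -- Multiplication by the similar triangles o, f, p and o, w, r.
  Product : Pt → Pt → Pt → Pt → Pt → Pt → Set (c ⊔ ℓ)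
  Product o e f p q r = ∃[ w ] Transfer o e f q w × Parallel w r f p

  module _ {o e : Pt} (e≉o : ¬ e ≐ᵖ o) where

    scale-injective : ∀ {x y} → scale o e x ≐ᵖ scale o e y → x ≈ y
    scale-injective {x} {y} eq with x ≟ y
    ... | yes x≈y = x≈y
    ... | no  x≉y = contradiction
      (λ i → x-y≈0⇒x≈y (x*y≈0⇒y≈0 (x≉y⇒x-y≉0 x≉y) (modulo 1# (eq i)
        (solve 4 (λ o e x y →
           (x :- y) :* (e :- o) := :0 :+ :1 :* (o :+ x :* (e :- o) :- (o :+ y :* (e :- o))))
          refl (o i) (e i) x y)))) e≉o

    -- If `y` were invertible, dividing by it would put `f` on `oe`; once `y` is 0, `x` vanishes
    -- because `e` differs from `o`.
    independent : ∀ {f} → ¬ Lin o f e → ∀ {x y} →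
                  (∀ i → x * (e i - o i) + y * (f i - o i) ≈ 0#) → x ≈ 0# × y ≈ 0#
    independent {f} f∉oe {x} {y} eq with y ≟ 0#
    ... | no y≉0 with k , k-inv ← inverse y y≉0 = contradiction
      ((- (k * x)) , λ i → modulo (- (f i - o i)) k-inv (modulo k (eq i)
        (solve 6 (λ o e f x y k →
           f := o :+ (:- (k :* x)) :* (e :- o) :+ (:- (f :- o)) :* (y :* k :- :1)
             :+ k :* (x :* (e :- o) :+ y :* (f :- o) :- :0))
          refl (o i) (e i) (f i) x y k))) f∉oe
    independent {f} f∉oe {x} {y} eq | yes y≈0 = scale-injective (λ i →
        modulo (- (f i - o i)) y≈0 (modulo 1# (eq i)
        (solve 5 (λ o e f x y →
           o :+ x :* (e :- o) := o :+ :0 :* (e :- o) :+ (:- (f :- o)) :* (y :- :0)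
             :+ :1 :* (x :* (e :- o) :+ y :* (f :- o) :- :0))
          refl (o i) (e i) (f i) x y))) , y≈0

    sum-⇔ : ∀ {x y z p q r} → p ≐ᵖ scale o e x → q ≐ᵖ scale o e y → r ≐ᵖ scale o e z →
            Translate o p q r ⇔ z ≈ x + y
    sum-⇔ {x} {y} {z} {p} {q} {r} p≈ q≈ r≈ = mk⇔
      (λ r≈′ → scale-injective (λ i → modulo (- 1#) (r≈ i) (modulo 1# (r≈′ i)
        (modulo 1# (p≈ i) (modulo 1# (q≈ i)
        (solve 8 (λ o e p q r x y z →
           o :+ z :* (e :- o) := o :+ (x :+ y) :* (e :- o)
             :+ (:- :1) :* (r :- (o :+ z :* (e :- o)))
             :+ :1 :* (r :- (q :+ (p :- o)))
             :+ :1 :* (p :- (o :+ x :* (e :- o)))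
             :+ :1 :* (q :- (o :+ y :* (e :- o))))
          refl (o i) (e i) (p i) (q i) (r i) x y z))))))
      (λ z≈ i → modulo 1# (r≈ i) (modulo (- 1#) (p≈ i) (modulo (- 1#) (q≈ i)
        (modulo (e i - o i) z≈
        (solve 8 (λ o e p q r x y z →
           r := q :+ (p :- o)
             :+ :1 :* (r :- (o :+ z :* (e :- o)))
             :+ (:- :1) :* (p :- (o :+ x :* (e :- o)))
             :+ (:- :1) :* (q :- (o :+ y :* (e :- o)))
             :+ (e :- o) :* (z :- (x :+ y)))
          refl (o i) (e i) (p i) (q i) (r i) x y z)))))

    -- For `f` equal to `e`, which occurs when the first axis is transferred to itself, parallelism
    -- forces `q` to be `p`. Otherwise the coefficients of `e - o` and `f - o` can be compared.
    transfer-⇔ : ∀ {f x p q} → f ≐ᵖ e ⊎ ¬ Lin o f e → p ≐ᵖ scale o e x →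
                 Transfer o e f p q ⇔ q ≐ᵖ scale o f x
    transfer-⇔ {f} {x} {p} {q} f≈e⊎f∉oe p≈ = mk⇔
      (λ ((m , q≈) , p∥q) → let l , pq≈ = to Parallel-⇔ p∥q in forth f≈e⊎f∉oe m q≈ l pq≈)
      (λ q≈ → (x , q≈) , from Parallel-⇔ (x , λ i → modulo 1# (q≈ i) (modulo (- 1#) (p≈ i)
        (solve 6 (λ o e f p q x →
           q :- p := x :* (f :- e) :+ :1 :* (q :- (o :+ x :* (f :- o)))
             :+ (:- :1) :* (p :- (o :+ x :* (e :- o))))
          refl (o i) (e i) (f i) (p i) (q i) x))))
      where
      forth : f ≐ᵖ e ⊎ ¬ Lin o f e → ∀ m → q ≐ᵖ scale o f m →
              ∀ l → (∀ i → q i - p i ≈ l * (f i - e i)) → q ≐ᵖ scale o f x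
      forth (inj₁ f≈e) m q≈ l pq≈ i = modulo 1# (pq≈ i) (modulo 1# (p≈ i)
        (modulo (l - x) (f≈e i)
        (solve 7 (λ o e f p q x l →
           q := o :+ x :* (f :- o) :+ :1 :* (q :- p :- l :* (f :- e))
             :+ :1 :* (p :- (o :+ x :* (e :- o))) :+ (l :- x) :* (f :- e))
          refl (o i) (e i) (f i) (p i) (q i) x l)))
      forth (inj₂ f∉oe) m q≈ l pq≈ i = modulo (f i - o i) l-x≈0
        (modulo (f i - o i) m-l≈0 (trans (q≈ i)
        (solve 5 (λ o f x l m →
           o :+ m :* (f :- o) := o :+ x :* (f :- o) :+ (f :- o) :* (l :- x :- :0)
             :+ (f :- o) :* (m :- l :- :0))
          refl (o i) (f i) x l m)))
        where
        coefficients = independent f∉oe {l - x} {m - l} (λ i →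
          modulo 1# (pq≈ i) (modulo (- 1#) (q≈ i) (modulo 1# (p≈ i)
          (solve 8 (λ o e f p q x l m →
             (l :- x) :* (e :- o) :+ (m :- l) :* (f :- o) :=
             :0 :+ :1 :* (q :- p :- l :* (f :- e))
               :+ (:- :1) :* (q :- (o :+ m :* (f :- o)))
               :+ :1 :* (p :- (o :+ x :* (e :- o))))
            refl (o i) (e i) (f i) (p i) (q i) x l m))))
        l-x≈0 = proj₁ coefficients
        m-l≈0 = proj₂ coefficients

    product-⇔ : ∀ {f x y z p q r} → ¬ Lin o f e →
                p ≐ᵖ scale o e x → q ≐ᵖ scale o e y → r ≐ᵖ scale o e z →
                Product o e f p q r ⇔ z ≈ x * y
    product-⇔ {f} {x} {y} {z} {p} {q} {r} f∉oe p≈ q≈ r≈ = mk⇔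
      (λ (w , q↦w , w∥r) →
        let w≈ = to (transfer-⇔ (inj₂ f∉oe) q≈) q↦w
            l , wr≈ = to Parallel-⇔ w∥r
            -- Comparing coefficients in `r - w = l (p - f)` gives `z = l x` and `l = y`.
            z≈ , y≈ = independent f∉oe {z - l * x} {l - y} (λ i →
              modulo 1# (wr≈ i) (modulo (- 1#) (r≈ i) (modulo 1# (w≈ i)
              (modulo l (p≈ i)
              (solve 10 (λ o e f p r w x y z l →
                 (z :- l :* x) :* (e :- o) :+ (l :- y) :* (f :- o) :=
                 :0 :+ :1 :* (r :- w :- l :* (p :- f))
                   :+ (:- :1) :* (r :- (o :+ z :* (e :- o)))
                   :+ :1 :* (w :- (o :+ y :* (f :- o)))
                   :+ l :* (p :- (o :+ x :* (e :- o))))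
                refl (o i) (e i) (f i) (p i) (r i) (w i) x y z l)))))
        in modulo 1# z≈ (modulo x y≈
             (solve 4 (λ x y z l →
                z := x :* y :+ :1 :* (z :- l :* x :- :0) :+ x :* (l :- y :- :0))
               refl x y z l)))
      (λ z≈ → scale o f y , from (transfer-⇔ (inj₂ f∉oe) q≈) (λ i → refl)
        , from Parallel-⇔ (y , λ i → modulo 1# (r≈ i) (modulo (- y) (p≈ i)
          (modulo (e i - o i) z≈
          (solve 8 (λ o e f p r x y z →
             r :- (o :+ y :* (f :- o)) := y :* (p :- f)
               :+ :1 :* (r :- (o :+ z :* (e :- o)))
               :+ (:- y) :* (p :- (o :+ x :* (e :- o)))
               :+ (e :- o) :* (z :- x :* y))
            refl (o i) (e i) (f i) (p i) (r i) x y z)))))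

  Sum : ∀ {m} → Pt → Vector Pt m → Pt → Set ℓ
  Sum o ys p = ∀ j → p j ≈ o j + sum (λ i → ys i j - o j)

  Sum-zero : ∀ {o p} {ys : Vector Pt 0} → p ≐ᵖ o ⇔ Sum o ys p
  Sum-zero = mk⇔ (λ p≈o j → trans (p≈o j) (sym (+-identityʳ _)))
                 (λ p≈ j → trans (p≈ j) (+-identityʳ _))

  -- Splits off one translation at a time, which makes the sum definable by recursion on its length.
  Sum-suc : ∀ {m o p} {ys : Vector Pt (suc m)} →
            (∃[ q ] Sum o (tail ys) q × Translate o (head ys) q p) ⇔ Sum o ys p
  Sum-suc {o = o} {p} {ys} = mk⇔
    (λ (q , q≈ , p≈) j → modulo 1# (q≈ j) (trans (p≈ j)
      (solve 4 (λ o y q s → q :+ (y :- o) := o :+ (y :- o :+ s) :+ :1 :* (q :- (o :+ s)))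
        refl (o j) (head ys j) (q j) _)))
    (λ p≈ → (λ j → o j + sum (λ i → tail ys i j - o j)) , (λ j → refl) , (λ j → trans (p≈ j)
      (solve 3 (λ o y s → o :+ (y :- o :+ s) := o :+ s :+ (y :- o)) refl (o j) (head ys j) _)))

  fromCoordinates : ∀ {m} → Pt → Vector Pt m → Vector Carrier m → Pt
  fromCoordinates o e x j = o j + sum (λ i → x i * (e i j - o j))

  -- A coordinate is represented by a point of the first axis, the copy of the field; it has to be
  -- transferred to its own axis before summing.
  HasCoordinates : ∀ {m} → Pt → Vector Pt (suc m) → Pt → Vector Pt (suc m) → Set (c ⊔ ℓ)
  HasCoordinates o e p xs = ∃[ ys ] (∀ i → Transfer o (e 0F) (e i) (xs i) (ys i)) × Sum o ys p

  module _ {m} {o : Pt} {e : Vector Pt (suc m)} (e₀≉o : ¬ e 0F ≐ᵖ o) where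

    hasCoordinates-⇔ : (∀ i → e i ≐ᵖ e 0F ⊎ ¬ Lin o (e i) (e 0F)) →
      ∀ {p xs x} → (∀ i → xs i ≐ᵖ scale o (e 0F) (x i)) →
      HasCoordinates o e p xs ⇔ p ≐ᵖ fromCoordinates o e x
    hasCoordinates-⇔ indep {p} {xs} {x} xs≈ = mk⇔
      (λ (ys , xs↦ys , p≈) j → trans (p≈ j) (+-congˡ (sum-cong-≋ (λ i →
        modulo 1# (to (transfer-⇔ e₀≉o (indep i) (xs≈ i)) (xs↦ys i) j)
          (solve 4 (λ o e y x → y :- o := x :* (e :- o) :+ :1 :* (y :- (o :+ x :* (e :- o))))
            refl (o j) (e i j) (ys i j) (x i))))))
      (λ p≈ → (λ i → scale o (e i) (x i))
        , (λ i → from (transfer-⇔ e₀≉o (indep i) (xs≈ i)) (λ j → refl))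
        , (λ j → trans (p≈ j) (+-congˡ (sum-cong-≋ (λ i →
            solve 3 (λ o e x → x :* (e :- o) := o :+ x :* (e :- o) :- o)
              refl (o j) (e i j) (x i))))))

-- The affine map determined by a frame.

module AffineMaps {c ℓ} (F : Field c ℓ) (em : ExcludedMiddle (c ⊔ ℓ)) (d : ℕ) where
  open Coordinates F em d public

  module _ (o : Pt) (e : Vector Pt d) where

    fromCoordinates-cong : ∀ {x y} → x ≐ᵖ y → fromCoordinates o e x ≐ᵖ fromCoordinates o e y
    fromCoordinates-cong x≈y j = +-congˡ (sum-cong-≋ {d} (λ i → *-congʳ (x≈y i)))

    private
      L : Pt → Pt
      L x j = sum (λ i → x i * (e i j - o j))

      L-scale : ∀ a x j → L (λ i → a * x i) j ≈ a * L x j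
      L-scale a x j = trans (sum-cong-≋ {d} (λ i → *-assoc a (x i) _)) (sym (*-distribˡ-sum {d} a _))

    -- `fromCoordinates o e` is `L` followed by the translation by `o`, so `L` inherits its
    -- bijectivity.
    fromCoordinates-affine :
      Injective _≐ᵖ_ _≐ᵖ_ (fromCoordinates o e) →
      StrictlySurjective _≐ᵖ_ (fromCoordinates o e) →
      IsAffineTransformation F d (fromCoordinates o e)
    fromCoordinates-affine injective surjective = record
      { linearPart = L
      ; linearPart-linear = record
        { isLeftModuleMonomorphism = record
          { isLeftModuleHomomorphism = record
            { +ᴹ-isGroupHomomorphism = record
              { isMonoidHomomorphism = record
                { isMagmaHomomorphism = record
                  { isRelHomomorphism = record { cong = L-cong }
                  ; homo = λ x y j → trans (sum-cong-≋ {d} (λ i → distribʳ _ (x i) (y i)))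
                                           (∑-distrib-+ {d} _ _)
                  }
                ; ε-homo = λ j → trans (sum-cong-≋ {d} (λ i → *-congʳ (sym (zeroˡ 0#))))
                    (trans (L-scale 0# (λ _ → 0#) j) (zeroˡ _))
                }
              ; ⁻¹-homo = λ x j → trans (sum-cong-≋ {d} (λ i →
                    *-congʳ (sym (-1*x≈-x (x i)))))
                  (trans (L-scale (- 1#) x j) (-1*x≈-x _))
              }
            ; *ₗ-homo = L-scale
            }
          ; injective = λ Lx≈Ly → injective (λ j → +-congˡ (Lx≈Ly j))
          }
        ; surjective = λ y → let x , eq = surjective (λ j → o j + y j) in
            x , λ x′≈x j → trans (L-cong x′≈x j) (modulo 1# (eq j)
              (solve 3 (λ o y s → s := y :+ :1 :* (o :+ s :- (o :+ y))) refl (o j) (y j) _))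
        }
      ; translation = o
      ; decomposition = λ x j → +-comm _ _
      }
      where
      open Algebra.Properties.Ring ring using (-1*x≈-x)
      L-cong : ∀ {x y} → x ≐ᵖ y → L x ≐ᵖ L y
      L-cong x≈y j = sum-cong-≋ {d} (λ i → *-congʳ (x≈y i))

  unit : ∀ {m n} → Fin m → Fin n → Carrier
  unit zero    zero    = 1#
  unit zero    (suc j) = 0#
  unit (suc i) zero    = 0#
  unit (suc i) (suc j) = unit i j

  origin : Pt
  origin _ = 0#

  sum-zero : ∀ {m} (x : Vector Carrier m) → sum (λ i → x i * (0# - 0#)) ≈ 0#
  sum-zero {zero}  x = refl
  sum-zero {suc m} x = trans
    (+-cong (solve 1 (λ x → x :* (:0 :- :0) := :0) refl (x 0F)) (sum-zero (tail x)))
    (+-identityʳ 0#)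

  sum-unit : ∀ {m} (x : Vector Carrier m) j → sum (λ i → x i * (unit i j - 0#)) ≈ x j
  sum-unit x zero    = trans
    (+-cong (solve 1 (λ x → x :* (:1 :- :0) := x) refl (x 0F)) (sum-zero (tail x)))
    (+-identityʳ _)
  sum-unit x (suc j) = trans
    (+-cong (solve 1 (λ x → x :* (:0 :- :0) := :0) refl (x 0F)) (sum-unit (tail x) j))
    (+-identityˡ _)

  fromCoordinates-unit : ∀ x → fromCoordinates origin unit x ≐ᵖ x
  fromCoordinates-unit x j = trans (+-identityˡ _) (sum-unit x j)

-- Dimension at least two: points off a line, frames, collinearity.

module PlaneAndBeyond {c ℓ} (F : Field c ℓ) (em : ExcludedMiddle (c ⊔ ℓ)) (d : ℕ) where
  open AffineMaps F em (suc (suc d)) public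

  -- The line cannot contain both `o + unit 0F` and `o + unit 1F`: with `v = q - o` this would give
  -- `1 = (a v₀)(b v₁) = (a v₁)(b v₀) = 0`.
  off-line : ∀ o q → ∃[ x ] ¬ Lin o x q
  off-line o q with em {Lin o (λ i → o i + unit {suc (suc d)} 0F i) q}
  ... | no ¬lin = _ , ¬lin
  ... | yes (a , eq) = (λ i → o i + unit {suc (suc d)} 1F i) , λ (b , eq′) → 1≉0 (
    modulo 1# (eq 0F) (modulo (a * (q 0F - o 0F)) (eq′ 1F)
      (modulo (- (a * (q 1F - o 1F))) (eq′ 0F)
      (solve 6 (λ o₀ o₁ q₀ q₁ a b →
         :1 := :0 :+ :1 :* (o₀ :+ :1 :- (o₀ :+ a :* (q₀ :- o₀)))
           :+ (a :* (q₀ :- o₀)) :* (o₁ :+ :1 :- (o₁ :+ b :* (q₁ :- o₁)))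
           :+ (:- (a :* (q₁ :- o₁))) :* (o₀ :+ :0 :- (o₀ :+ b :* (q₀ :- o₀))))
        refl (o 0F) (o 1F) (q 0F) (q 1F) a b))))

  unit-diagonal : ∀ {n} (i : Fin n) → unit i i ≡ 1#
  unit-diagonal zero    = ≡.refl
  unit-diagonal (suc i) = unit-diagonal i

  unit≉origin : ∀ (i : Fin (suc (suc d))) → ¬ unit i ≐ᵖ origin
  unit≉origin i eq = 1≉0 (trans (reflexive (≡.sym (unit-diagonal i))) (eq i))

  unit∉axis : ∀ (i : Fin (suc d)) → ¬ Lin origin (unit (suc i)) (unit {suc (suc d)} 0F)
  unit∉axis i (a , eq) = 1≉0 (trans (reflexive (≡.sym (unit-diagonal i)))
    (trans (eq (suc i)) (solve 1 (λ a → :0 :+ a :* (:0 :- :0) := :0) refl a)))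

  -- Contains just what transfer from the first axis to the others requires; that `e` spans the
  -- space independently is added in `IsCoordinateSystem`.
  Frame : Pt → Vector Pt (suc (suc d)) → Set (c ⊔ ℓ)
  Frame o e = ¬ e 0F ≐ᵖ o × (∀ i → ¬ Lin o (e (suc i)) (e 0F))

  -- For `r` equal to `p`, `Collinear` leaves `q` arbitrary, whereas `Lin` makes it equal to `p`.
  LinByCollinear : Pt → Pt → Pt → Set (c ⊔ ℓ)
  LinByCollinear p q r = Collinear F (suc (suc d)) p q r × (r ≐ᵖ p → q ≐ᵖ p)

  collinear-⇔ : ∀ {p q r} → LinByCollinear p q r ⇔ Lin p q r
  collinear-⇔ {p} {q} {r} = mk⇔
    (λ { (inj₁ lin , _) → lin
       ; (inj₂ r≈p , h) → 0# , λ i → trans (h r≈p i)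
           (solve 2 (λ p r → p := p :+ :0 :* (r :- p)) refl (p i) (r i)) })
    (λ (l , q≈) → inj₁ (l , q≈) , λ r≈p i → modulo l (r≈p i) (trans (q≈ i)
      (solve 3 (λ p r l → p :+ l :* (r :- p) := p :+ l :* (r :- p)) refl (p i) (r i) l)))

-- Ordered fields and betweenness.

module OrderedProperties {c ℓ} (F : OrderedField c ℓ) (em : ExcludedMiddle (c ⊔ ℓ)) where
  open OrderedField F using (field′; _≤_; +-monoˡ-≤; *-nonNeg; isTotalOrder)
  open IsTotalOrder isTotalOrder using (total; antisym; ≤-respˡ-≈; ≤-respʳ-≈)
  open FieldProperties field′ em

  0≤y-x⇒x≤y : ∀ {x y} → 0# ≤ y - x → x ≤ y
  0≤y-x⇒x≤y {x} {y} h = ≤-respˡ-≈ (+-identityˡ x) (≤-respʳ-≈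
    (solve 2 (λ x y → y :- x :+ x := y) refl x y) (+-monoˡ-≤ x h))

  x≤y⇒0≤y-x : ∀ {x y} → x ≤ y → 0# ≤ y - x
  x≤y⇒0≤y-x {x} {y} h = ≤-respˡ-≈ (-‿inverseʳ x) (+-monoˡ-≤ (- x) h)

  -- If 1 were at most 0, then -1 would be nonnegative, and so would its square.
  0≤1 : 0# ≤ 1#
  0≤1 with total 0# 1#
  ... | inj₁ h = h
  ... | inj₂ 1≤0 = ≤-respʳ-≈ (solve 0 ((:0 :- :1) :* (:0 :- :1) := :1) refl)
                     (*-nonNeg (x≤y⇒0≤y-x 1≤0) (x≤y⇒0≤y-x 1≤0))

  1≰0 : ¬ 1# ≤ 0#
  1≰0 1≤0 = 1≉0 (antisym 1≤0 0≤1)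

  2≉0 : ¬ 1# + 1# ≈ 0#
  2≉0 2≈0 = 1≰0 (≤-respʳ-≈ 2≈0 (0≤y-x⇒x≤y
    (≤-respʳ-≈ (solve 0 (:1 := :1 :+ :1 :- :1) refl) 0≤1)))

  2≉1 : ¬ 1# + 1# ≈ 1#
  2≉1 2≈1 = 1≉0 (modulo 1# 2≈1 (solve 0 (:1 := :0 :+ :1 :* (:1 :+ :1 :- :1)) refl))

  -- A nonpositive `y` would make `x * (0# - y)`, which is -1, nonnegative.
  nonNeg-cofactor : ∀ {x y} → 0# ≤ x → x * y ≈ 1# → 0# ≤ y
  nonNeg-cofactor {x} {y} 0≤x xy≈1 with total 0# y
  ... | inj₁ 0≤y = 0≤y
  ... | inj₂ y≤0 = contradiction (0≤y-x⇒x≤y (≤-respʳ-≈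
          (modulo (- 1#) xy≈1 (solve 2 (λ x y →
            x :* (:0 :- y) := :0 :- :1 :+ (:- :1) :* (x :* y :- :1)) refl x y))
          (*-nonNeg 0≤x (x≤y⇒0≤y-x y≤0)))) 1≰0

  -- A parameter beyond 1 turns into one between 0 and 1 when two of the points on the line exchange
  -- roles.
  reciprocal≤1 : ∀ {x} → 1# ≤ x → ∃[ y ] x * y ≈ 1# × 0# ≤ y × y ≤ 1#
  reciprocal≤1 {x} 1≤x with y , xy≈1 ← inverse x (λ x≈0 → 1≰0 (≤-respʳ-≈ x≈0 1≤x)) =
    y , xy≈1 , 0≤y , 0≤y-x⇒x≤y (≤-respʳ-≈
      (modulo 1# xy≈1 (solve 2 (λ x y →
        (x :- :1) :* y := :1 :- y :+ :1 :* (x :* y :- :1)) refl x y))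
      (*-nonNeg (x≤y⇒0≤y-x 1≤x) 0≤y))
    where
    0≤y : 0# ≤ y
    0≤y = nonNeg-cofactor (0≤y-x⇒x≤y (≤-respʳ-≈
      (solve 1 (λ x → x :- :1 :+ :1 := x :- :0) refl x)
      (0≤+ (x≤y⇒0≤y-x 1≤x)))) xy≈1
      where
      0≤+ : ∀ {z} → 0# ≤ z → 0# ≤ z + 1#
      0≤+ 0≤z = IsTotalOrder.trans isTotalOrder 0≤1
        (≤-respˡ-≈ (+-identityˡ 1#) (+-monoˡ-≤ 1# 0≤z))

module OrderedGeometry {c ℓ} (F : OrderedField c ℓ) (em : ExcludedMiddle (c ⊔ ℓ)) (d : ℕ) where
  open OrderedField F using (field′; _≤_; isTotalOrder)
  open IsTotalOrder isTotalOrder using (total; ≤-respˡ-≈; ≤-respʳ-≈)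
  open OrderedProperties F em
  open Coordinates field′ em d

  Bw : Pt → Pt → Pt → Set (c ⊔ ℓ)
  Bw = Between F d

  -- The condition on the last two cases is needed because `Bw p r q` and `Bw r p q` hold for every
  -- `q` when `r` equals `p`.
  LinByBetween : Pt → Pt → Pt → Set (c ⊔ ℓ)
  LinByBetween p q r = Bw p q r ⊎ (¬ r ≐ᵖ p × (Bw p r q ⊎ Bw r p q))

  between-⇔ : ∀ {p q r} → LinByBetween p q r ⇔ Lin p q r
  between-⇔ {p} {q} {r} = mk⇔ forth back
    where
    nonzero : ∀ {a} {x y z : Pt} → ¬ y ≐ᵖ x → (∀ i → y i ≈ x i + a * (z i - x i)) → ¬ a ≈ 0#
    nonzero {a} {x} {y} {z} y≉x y≈ a≈0 = y≉x (λ i → modulo (z i - x i) a≈0 (trans (y≈ i)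
      (solve 3 (λ x z a → x :+ a :* (z :- x) := x :+ (z :- x) :* (a :- :0))
        refl (x i) (z i) a)))
    forth : LinByBetween p q r → Lin p q r
    forth (inj₁ (a , _ , _ , q≈)) = a , q≈
    forth (inj₂ (r≉p , inj₁ (a , _ , _ , r≈)))
      with k , ak≈1 ← inverse a (nonzero r≉p r≈) =
      k , λ i → modulo (- (q i - p i)) ak≈1 (modulo (- k) (r≈ i)
        (solve 5 (λ p q r a k →
           q := p :+ k :* (r :- p) :+ (:- (q :- p)) :* (a :* k :- :1)
             :+ (:- k) :* (r :- (p :+ a :* (q :- p))))
          refl (p i) (q i) (r i) a k))
    forth (inj₂ (r≉p , inj₂ (a , _ , _ , p≈)))
      with k , ak≈1 ← inverse a (nonzero (λ p≈r → r≉p (λ i → sym (p≈r i))) p≈) =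
      1# - k , λ i → modulo (- (q i - r i)) ak≈1 (modulo (- k) (p≈ i)
        (solve 5 (λ p q r a k →
           q := p :+ (:1 :- k) :* (r :- p) :+ (:- (q :- r)) :* (a :* k :- :1)
             :+ (:- k) :* (p :- (r :+ a :* (q :- r))))
          refl (p i) (q i) (r i) a k))
    back : Lin p q r → LinByBetween p q r
    back (a , q≈) with r ≟ᵖ p
    ... | yes r≈p = inj₁ (0# , IsTotalOrder.refl isTotalOrder , 0≤1 , λ i →
      modulo a (r≈p i) (trans (q≈ i)
        (solve 3 (λ p r a → p :+ a :* (r :- p) := p :+ :0 :* (r :- p) :+ a :* (r :- p))
          refl (p i) (r i) a)))
    ... | no r≉p = [ (λ 0≤a → [ (λ a≤1 → inj₁ (a , 0≤a , a≤1 , q≈)) , beyond ]′ (total a 1#))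
                   , behind ]′ (total 0# a)
      where
      beyond : 1# ≤ a → LinByBetween p q r
      beyond 1≤a = let k , ak≈1 , 0≤k , k≤1 = reciprocal≤1 1≤a in
        inj₂ (r≉p , inj₁ (k , 0≤k , k≤1 , λ i →
          modulo (- (r i - p i)) ak≈1 (modulo (- k) (q≈ i)
          (solve 5 (λ p q r a k →
             r := p :+ k :* (q :- p) :+ (:- (r :- p)) :* (a :* k :- :1)
               :+ (:- k) :* (q :- (p :+ a :* (r :- p))))
            refl (p i) (q i) (r i) a k))))
      behind : a ≤ 0# → LinByBetween p q r
      behind a≤0 =
        -- Since `q - r = (1 - a)(p - r)`, the point `p` has parameter `1/(1 - a)` on the line from
        -- `r` to `q`.
        let k , inv , 0≤k , k≤1 = reciprocal≤1 {1# - a} (0≤y-x⇒x≤y (≤-respʳ-≈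
              (solve 1 (λ a → :0 :- a := :1 :- a :- :1) refl a) (x≤y⇒0≤y-x a≤0)))
        in inj₂ (r≉p , inj₂ (k , 0≤k , k≤1 , λ i →
          modulo (- (p i - r i)) inv (modulo (- k) (q≈ i)
          (solve 5 (λ p q r a k →
             p := r :+ k :* (q :- r) :+ (:- (p :- r)) :* ((:1 :- a) :* k :- :1)
               :+ (:- k) :* (q :- (p :+ a :* (r :- p))))
            refl (p i) (q i) (r i) a k))))

  -- The order is read off from the difference `w`, which has to lie on the ray from `o` through
  -- `e`; the last clause describes this ray by betweenness.
  Leq : Pt → Pt → Pt → Pt → Set (c ⊔ ℓ)
  Leq o e p q = ∃[ w ] Lin o w e × Translate o p w q × (Bw o w e ⊎ Bw o e w)

  module _ {o e : Pt} (e≉o : ¬ e ≐ᵖ o) where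

    nonNeg-⇔ : ∀ {x p} → p ≐ᵖ scale o e x → (Bw o p e ⊎ Bw o e p) ⇔ 0# ≤ x
    nonNeg-⇔ {x} {p} p≈ = mk⇔ forth back
      where
      forth : Bw o p e ⊎ Bw o e p → 0# ≤ x
      forth (inj₁ (a , 0≤a , _ , p≈′)) =
        ≤-respʳ-≈ (scale-injective e≉o (λ i → trans (sym (p≈′ i)) (p≈ i))) 0≤a
      forth (inj₂ (a , 0≤a , _ , e≈)) = nonNeg-cofactor 0≤a (sym (scale-injective e≉o (λ i →
        modulo 1# (e≈ i) (modulo a (p≈ i)
          (solve 5 (λ o e p x a →
             o :+ :1 :* (e :- o) := o :+ (a :* x) :* (e :- o)
               :+ :1 :* (e :- (o :+ a :* (p :- o))) :+ a :* (p :- (o :+ x :* (e :- o))))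
            refl (o i) (e i) (p i) x a)))))
      back : 0# ≤ x → Bw o p e ⊎ Bw o e p
      back 0≤x = [ (λ x≤1 → inj₁ (x , 0≤x , x≤1 , p≈)) , beyond ]′ (total x 1#)
        where
        beyond : 1# ≤ x → Bw o p e ⊎ Bw o e p
        beyond 1≤x = let k , xk≈1 , 0≤k , k≤1 = reciprocal≤1 1≤x in
          inj₂ (k , 0≤k , k≤1 , λ i → modulo (- (e i - o i)) xk≈1 (modulo (- k) (p≈ i)
            (solve 5 (λ o e p x k →
               e := o :+ k :* (p :- o) :+ (:- (e :- o)) :* (x :* k :- :1)
                 :+ (:- k) :* (p :- (o :+ x :* (e :- o))))
              refl (o i) (e i) (p i) x k)))

    leq-⇔ : ∀ {x y p q} → p ≐ᵖ scale o e x → q ≐ᵖ scale o e y → Leq o e p q ⇔ x ≤ y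
    leq-⇔ {x} {y} {p} {q} p≈ q≈ = mk⇔
      (λ (w , (z , w≈) , w+p≈q , 0≤w) → 0≤y-x⇒x≤y (≤-respʳ-≈
        (modulo (- 1#) (to (sum-⇔ e≉o p≈ w≈ q≈) w+p≈q)
          (solve 3 (λ x y z → z := y :- x :+ (:- :1) :* (y :- (x :+ z))) refl x y z))
        (to (nonNeg-⇔ w≈) 0≤w)))
      (λ x≤y → scale o e (y - x) , (y - x , λ i → refl)
        , from (sum-⇔ e≉o p≈ (λ i → refl) q≈)
            (solve 2 (λ x y → y := x :+ (y :- x)) refl x y)
        , from (nonNeg-⇔ (λ i → refl)) (x≤y⇒0≤y-x x≤y))

-- A scalar other than 0 and 1.

module _ (F : Field c ℓ) (em : ExcludedMiddle (c ⊔ ℓ)) where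
  open FieldProperties F em

  third-element : MoreThanTwoElements F → ∃[ t ] ¬ t ≈ 0# × ¬ t ≈ 1#
  third-element (x , x-injective) with em {∃[ t ] ¬ t ≈ 0# × ¬ t ≈ 1#}
  ... | yes t  = t
  ... | no  ∄t = pigeonhole (zero-or-one 0F) (zero-or-one 1F) (zero-or-one 2F)
    where
    zero-or-one : ∀ i → x i ≈ 0# ⊎ x i ≈ 1#
    zero-or-one i with x i ≟ 0# | x i ≟ 1#
    ... | yes x≈0 | _       = inj₁ x≈0
    ... | no  _   | yes x≈1 = inj₂ x≈1
    ... | no  x≉0 | no  x≉1 = contradiction (x i , x≉0 , x≉1) ∄t
    distinct : ∀ {i j z} {A : Set (c ⊔ ℓ)} → ¬ i ≡ j → x i ≈ z → x j ≈ z → A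
    distinct i≢j xi≈z xj≈z = contradiction (x-injective (trans xi≈z (sym xj≈z))) i≢j
    pigeonhole : ∀ {A : Set (c ⊔ ℓ)} → x 0F ≈ 0# ⊎ x 0F ≈ 1# → x 1F ≈ 0# ⊎ x 1F ≈ 1# →
                 x 2F ≈ 0# ⊎ x 2F ≈ 1# → A
    pigeonhole (inj₁ a) (inj₁ b) _        = distinct (λ ()) a b
    pigeonhole (inj₁ a) (inj₂ _) (inj₁ b) = distinct (λ ()) a b
    pigeonhole (inj₁ _) (inj₂ a) (inj₂ b) = distinct (λ ()) a b
    pigeonhole (inj₂ a) (inj₂ b) _        = distinct (λ ()) a b
    pigeonhole (inj₂ a) (inj₁ _) (inj₂ b) = distinct (λ ()) a b
    pigeonhole (inj₂ _) (inj₁ a) (inj₁ b) = distinct (λ ()) a b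

non-boolean : (𝔉 : BaseField c ℓ) → ExcludedMiddle (c ⊔ ℓ) →
  let open Field (underlyingField 𝔉) in ∃[ t ] ¬ t ≈ 0# × ¬ t ≈ 1#
non-boolean (plain F more-than-two) em = third-element F em more-than-two
-- The scalar is `1# + 1#`, nonzero because of the order.
non-boolean (ordered F) em = _ , 2≉0 , 2≉1
  where open OrderedProperties F em

-- Definability of the geometric constructions.

module BasicDefinability (𝔉 : BaseField c ℓ) (d : ℕ) (𝒢 : CoordinateGeometry 𝔉 (suc (suc d)) r)
                         (em : ExcludedMiddle (c ⊔ ℓ)) where
  open CoordinateGeometry 𝒢 using (structure; basicRelation-definable)
  open Definability structure using (Def; Definable⇒Def; def-reindex)
  open PlaneAndBeyond (underlyingField 𝔉) em d

  basic-def : ∀ (p q r : V) → Def (λ σ → basicRelation 𝔉 (suc (suc d)) (λ i → σ ((p ∷ q ∷ r ∷ []) i)))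
  basic-def p q r = def-reindex (p ∷ q ∷ r ∷ []) (Definable⇒Def basicRelation-definable)

-- From here on plain and ordered fields are treated alike; only the order symbol in `tr-baseRel`
-- returns to betweenness.
lin-def : (𝔉 : BaseField c ℓ) (𝒢 : CoordinateGeometry 𝔉 (suc (suc d)) r)
          (em : ExcludedMiddle (c ⊔ ℓ)) →
          let open CoordinateGeometry 𝒢 ; open Definability structure using (Def)
              open AffineGeometry (underlyingField 𝔉) em (suc (suc d)) in
          (p q r : V) → Def (λ σ → Lin (σ p) (σ q) (σ r))
lin-def {d = d} 𝔉@(plain F _) 𝒢 em p q r = def-⇔ (λ σ → collinear-⇔)
  (basic-def p q r def-× (def-≈ r p def-→ def-≈ q p))
  where
  open Definability (CoordinateGeometry.structure 𝒢)
  open BasicDefinability 𝔉 d 𝒢 em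
  open PlaneAndBeyond F em d using (collinear-⇔)
lin-def {d = d} 𝔉@(ordered F) 𝒢 em p q r = def-⇔ (λ σ → between-⇔)
  (basic-def p q r def-⊎ def-¬ (def-≈ r p) def-× (basic-def p r q def-⊎ basic-def r p q))
  where
  open Definability (CoordinateGeometry.structure 𝒢)
  open BasicDefinability 𝔉 d 𝒢 em
  open OrderedGeometry F em (suc (suc d)) using (between-⇔)

module Constructions (𝔉 : BaseField c ℓ) {d : ℕ} (𝒢 : CoordinateGeometry 𝔉 (suc (suc d)) r)
                     (em : ExcludedMiddle (c ⊔ ℓ)) where
  open Definability (CoordinateGeometry.structure 𝒢) public
    using ( Def; def-≈; def-¬; _def-×_; _def-⊎_; _def-→_; def-∃; def-∀; def-∃ⁿ; def-∀ⁿ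
          ; def-⋀; def-⇔; def-⊥ )
  open PlaneAndBeyond (underlyingField 𝔉) em d public

  D : ℕ
  D = suc (suc d)

  line-def : (p q r : V) → Def (λ σ → Lin (σ p) (σ q) (σ r))
  line-def = lin-def 𝔉 𝒢 em

  disjoint-def : (p r o q : V) → Def (λ σ → Disjoint (σ p) (σ r) (σ o) (σ q))
  disjoint-def p r o q = def-¬ (def-∃
    (line-def (just p) nothing (just r) def-× line-def (just o) nothing (just q)))

  parallelogram-def : (o q p r : V) → Def (λ σ → Parallelogram (σ o) (σ q) (σ p) (σ r))
  parallelogram-def o q p r =
    def-¬ (def-≈ q o) def-× def-¬ (line-def o p q)
    def-× def-∃ (def-∃
      (line-def (just (just o)) (just nothing) (just (just p))
       def-× line-def (just (just o)) nothing (just (just q))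
       def-× line-def (just nothing) (just (just r)) nothing))
    def-× disjoint-def p r o q def-× disjoint-def q r o p

  translate-def : (o q p r : V) → Def (λ σ → Translate (σ o) (σ q) (σ p) (σ r))
  translate-def o q p r = def-⇔
    -- The scalar `t` serves to prove the equivalence; the formula itself does not mention it and so
    -- remains free of parameters.
    (λ σ → let t , t≉0 , t≉1 = non-boolean 𝔉 em in
      mk⇔ (TranslateByLin⇒Translate t t≉0 t≉1) (Translate⇒TranslateByLin t t≉0 t≉1 off-line))
    ((def-≈ q o def-× def-≈ r p)
     def-⊎ def-∃ (def-∃
       (parallelogram-def (just (just o)) (just (just q)) (just nothing) nothing
        def-× parallelogram-def (just nothing) nothing (just (just p)) (just (just r)))))

  parallel-def : (a b p q : V) → Def (λ σ → Parallel (σ a) (σ b) (σ p) (σ q))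
  parallel-def a b p q = def-∃
    (translate-def (just a) (just b) (just p) nothing def-× line-def (just p) nothing (just q))

  transfer-def : (o e f p q : V) → Def (λ σ → Transfer (σ o) (σ e) (σ f) (σ p) (σ q))
  transfer-def o e f p q = line-def o q f def-× parallel-def p q e f

  product-def : (o e f p q r : V) → Def (λ σ → Product (σ o) (σ e) (σ f) (σ p) (σ q) (σ r))
  product-def o e f p q r = def-∃
    (transfer-def (just o) (just e) (just f) (just q) nothing
     def-× parallel-def nothing (just r) (just f) (just p))

  sum-def : (o : V) (ys : Fin m → V) (p : V) → Def (λ σ → Sum (σ o) (σ ∘ ys) (σ p))
  sum-def {m = zero}  o ys p = def-⇔ (λ σ → Sum-zero {ys = σ ∘ ys}) (def-≈ p o)
  sum-def {m = suc m} o ys p = def-⇔ (λ σ → Sum-suc {m} {ys = σ ∘ ys}) (def-∃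
    (sum-def (just o) (just ∘ tail ys) nothing
     def-× translate-def (just o) (just (head ys)) nothing (just p)))

  hasCoordinates-def : (o : V) (e : Fin D → V) (p : V) (xs : Fin D → V) →
    Def (λ σ → HasCoordinates (σ o) (σ ∘ e) (σ p) (σ ∘ xs))
  hasCoordinates-def o e p xs = def-∃ⁿ D
    (def-⋀ D (λ i → transfer-def (inj₂ o) (inj₂ (e 0F)) (inj₂ (e i)) (inj₂ (xs i)) (inj₁ i))
     def-× sum-def (inj₂ o) inj₁ (inj₂ p))

  onAxis-def : (o e : V) (xs : Fin m → V) → Def (λ σ → ∀ i → Lin (σ o) (σ (xs i)) (σ e))
  onAxis-def {m = m} o e xs = def-⋀ m (λ i → line-def o (xs i) e)

  frame-def : (o : V) (e : Fin D → V) → Def (λ σ → Frame (σ o) (σ ∘ e))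
  frame-def o e = def-¬ (def-≈ (e 0F) o)
    def-× def-⋀ (suc d) (λ i → def-¬ (line-def o (e (suc i)) (e 0F)))

  IsCoordinateSystem : Pt → Vector Pt D → Set (c ⊔ ℓ)
  IsCoordinateSystem o e = Frame o e
    × (∀ x y → fromCoordinates o e x ≐ᵖ fromCoordinates o e y → x ≐ᵖ y)
    × (∀ p → ∃[ x ] p ≐ᵖ fromCoordinates o e x)

  module _ {o : Pt} {e : Vector Pt D} (frame : Frame o e) where

    frame-⇔ : ∀ {p xs x} → (∀ i → xs i ≐ᵖ scale o (e 0F) (x i)) →
              HasCoordinates o e p xs ⇔ p ≐ᵖ fromCoordinates o e x
    frame-⇔ = hasCoordinates-⇔ (proj₁ frame)
      (λ { zero → inj₁ (λ _ → refl) ; (suc i) → inj₂ (proj₂ frame i) })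

    -- Here and in `total-⇔`, quantification over scalars becomes quantification over points of the
    -- first axis, which the geometry can express.
    unique-⇔ :
      (∀ p xs ys → (∀ i → Lin o (xs i) (e 0F)) → (∀ i → Lin o (ys i) (e 0F)) →
         HasCoordinates o e p xs → HasCoordinates o e p ys → ∀ i → xs i ≐ᵖ ys i)
      ⇔ (∀ x y → fromCoordinates o e x ≐ᵖ fromCoordinates o e y → x ≐ᵖ y)
    unique-⇔ = mk⇔
      (λ unique x y eq i → scale-injective (proj₁ frame) (unique (fromCoordinates o e y)
         (λ i → scale o (e 0F) (x i)) (λ i → scale o (e 0F) (y i))
         (λ i → x i , λ _ → refl) (λ i → y i , λ _ → refl)
         (from (frame-⇔ (λ _ _ → refl)) (λ j → sym (eq j)))
         (from (frame-⇔ (λ _ _ → refl)) (λ _ → refl)) i))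
      (λ injective p xs ys xs∈ ys∈ p↦xs p↦ys i j →
         let x = proj₁ ∘ xs∈
             y = proj₁ ∘ ys∈
             x≈y = injective x y (λ j → trans (sym (to (frame-⇔ (proj₂ ∘ xs∈)) p↦xs j))
                                              (to (frame-⇔ (proj₂ ∘ ys∈)) p↦ys j))
         in trans (proj₂ (xs∈ i) j) (trans (+-congˡ (*-congʳ (x≈y i))) (sym (proj₂ (ys∈ i) j))))

    total-⇔ :
      (∀ p → ∃[ xs ] (∀ i → Lin o (xs i) (e 0F)) × HasCoordinates o e p xs)
      ⇔ (∀ p → ∃[ x ] p ≐ᵖ fromCoordinates o e x)
    total-⇔ = ∀-⇔ (λ p → mk⇔
      (λ (xs , xs∈ , p↦xs) → proj₁ ∘ xs∈ , to (frame-⇔ (proj₂ ∘ xs∈)) p↦xs)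
      (λ (x , p≈) → (λ i → scale o (e 0F) (x i)) , (λ i → x i , λ _ → refl)
         , from (frame-⇔ (λ _ _ → refl)) p≈))

  coordinateSystem-def : (o : V) (e : Fin D → V) → Def (λ σ → IsCoordinateSystem (σ o) (σ ∘ e))
  coordinateSystem-def o e = def-⇔
    (λ σ → mk⇔
      (λ (frame , unique , total) → frame , to (unique-⇔ frame) unique , to (total-⇔ frame) total)
      (λ (frame , injective , surjective) →
         frame , from (unique-⇔ frame) injective , from (total-⇔ frame) surjective))
    (frame-def o e
     def-× def-∀ (def-∀ⁿ D (def-∀ⁿ D
       (onAxis-def (inj₂ (inj₂ (just o))) (inj₂ (inj₂ (just (e 0F)))) (inj₂ ∘ inj₁)
        def-→ onAxis-def (inj₂ (inj₂ (just o))) (inj₂ (inj₂ (just (e 0F)))) inj₁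
        def-→ hasCoordinates-def (inj₂ (inj₂ (just o))) (λ i → inj₂ (inj₂ (just (e i))))
                (inj₂ (inj₂ nothing)) (inj₂ ∘ inj₁)
        def-→ hasCoordinates-def (inj₂ (inj₂ (just o))) (λ i → inj₂ (inj₂ (just (e i))))
                (inj₂ (inj₂ nothing)) inj₁
        def-→ def-⋀ D (λ i → def-≈ (inj₂ (inj₁ i)) (inj₁ i)))))
     def-× def-∀ (def-∃ⁿ D
       (onAxis-def (inj₂ (just o)) (inj₂ (just (e 0F))) inj₁
        def-× hasCoordinates-def (inj₂ (just o)) (λ i → inj₂ (just (e i))) (inj₂ nothing) inj₁)))

-- Translation of field formulas into the geometry.

module Translation (𝔉 : BaseField c ℓ) {d : ℕ} (𝒢 : CoordinateGeometry 𝔉 (suc (suc d)) r)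
                   (em : ExcludedMiddle (c ⊔ ℓ)) where
  open Constructions 𝔉 𝒢 em public

  Represents : Pt → Pt → (W → Pt) → (W → Carrier) → Set ℓ
  Represents o e ps a = ∀ w → ps w ≐ᵖ scale o e (a w)

  -- Scalars are interpreted by the points of the first axis, the second axis
  -- being needed for multiplication.
  Translatable : {W : Set} → ((W → Carrier) → Set s) → Set (lsuc (c ⊔ ℓ) ⊔ r ⊔ s)
  Translatable {W = W} T = ∀ {V : Set} (o e f : V) (ps : W → V) →
    ∃[ P ] Def {s = c ⊔ ℓ} P × (∀ σ a → ¬ σ e ≐ᵖ σ o → ¬ Lin (σ o) (σ f) (σ e) →
      Represents (σ o) (σ e) (σ ∘ ps) a → P σ ⇔ T a)

  private
    variable
      T : (W → Carrier) → Set s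
      U : (W → Carrier) → Set s′

  scale-cong : ∀ o e {x y} → x ≈ y → scale o e x ≐ᵖ scale o e y
  scale-cong o e x≈y j = +-congˡ (*-congʳ x≈y)

  tr-⇔ : (∀ a → T a ⇔ U a) → Translatable T → Translatable U
  tr-⇔ T⇔U T-tr o e f ps = let P , P-def , P⇔T = T-tr o e f ps in
    P , P-def , λ σ a e≉o f∉oe ps~a → P⇔T σ a e≉o f∉oe ps~a ⨾ T⇔U a

  tr-reindex : (g : W → W′) → Translatable T → Translatable (λ a → T (a ∘ g))
  tr-reindex g T-tr o e f ps = let P , P-def , P⇔T = T-tr o e f (ps ∘ g) in
    P , P-def , λ σ a e≉o f∉oe ps~a → P⇔T σ (a ∘ g) e≉o f∉oe (ps~a ∘ g)

  tr-⊥ : Translatable {W = W} (λ _ → ⊥)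
  tr-⊥ o e f ps = (λ _ → Lift _ ⊥)
    , def-⇔ (λ _ → Lift-⇔) def-⊥
    , λ σ a e≉o f∉oe ps~a → ⇔-sym Lift-⇔

  tr-× : Translatable T → Translatable U → Translatable (λ a → T a × U a)
  tr-× T-tr U-tr o e f ps =
    let P , P-def , P⇔T = T-tr o e f ps ; Q , Q-def , Q⇔U = U-tr o e f ps in
    (λ σ → P σ × Q σ) , P-def def-× Q-def , λ σ a e≉o f∉oe ps~a →
      P⇔T σ a e≉o f∉oe ps~a ×-⇔ Q⇔U σ a e≉o f∉oe ps~a

  tr-⊎ : Translatable T → Translatable U → Translatable (λ a → T a ⊎ U a)
  tr-⊎ T-tr U-tr o e f ps =
    let P , P-def , P⇔T = T-tr o e f ps ; Q , Q-def , Q⇔U = U-tr o e f ps in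
    (λ σ → P σ ⊎ Q σ) , P-def def-⊎ Q-def , λ σ a e≉o f∉oe ps~a →
      P⇔T σ a e≉o f∉oe ps~a ⊎-⇔ Q⇔U σ a e≉o f∉oe ps~a

  tr-→ : Translatable T → Translatable U → Translatable (λ a → T a → U a)
  tr-→ T-tr U-tr o e f ps =
    let P , P-def , P⇔T = T-tr o e f ps ; Q , Q-def , Q⇔U = U-tr o e f ps in
    (λ σ → P σ → Q σ) , (P-def def-→ Q-def) , λ σ a e≉o f∉oe ps~a →
      →-cong-⇔ (P⇔T σ a e≉o f∉oe ps~a) (Q⇔U σ a e≉o f∉oe ps~a)

  private
    represents-∷ : ∀ {o e} (σ : V → Pt) (ps : Fin m → V) {a p x} →
                   Represents o e (σ ∘ ps) a → p ≐ᵖ scale o e x →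
                   Represents o e (maybe′ σ p ∘ (nothing ∷ just ∘ ps)) (x ∷ a)
    represents-∷ σ ps ps~a p~x zero    = p~x
    represents-∷ σ ps ps~a p~x (suc i) = ps~a i

  -- Quantifiers over scalars are relativized to the first axis.
  tr-∃ : {T : Vector Carrier (suc m) → Set s} → Translatable T →
         Translatable (λ a → ∃[ x ] T (x ∷ a))
  tr-∃ T-tr o e f ps =
    let P , P-def , P⇔T = T-tr (just o) (just e) (just f) (nothing ∷ just ∘ ps) in
    (λ σ → ∃[ p ] Lin (σ o) p (σ e) × P (maybe′ σ p))
    , def-∃ (line-def (just o) nothing (just e) def-× P-def)
    , λ σ a e≉o f∉oe ps~a → mk⇔
        (λ (p , (x , p≈) , Pp) →
           x , to (P⇔T _ (x ∷ a) e≉o f∉oe (represents-∷ σ ps ps~a p≈)) Pp)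
        (λ (x , Tx) → scale (σ o) (σ e) x , (x , λ _ → refl)
           , from (P⇔T _ (x ∷ a) e≉o f∉oe (represents-∷ σ ps ps~a (λ _ → refl))) Tx)

  tr-∀ : {T : Vector Carrier (suc m) → Set s} → Translatable T →
         Translatable (λ a → ∀ x → T (x ∷ a))
  tr-∀ T-tr o e f ps =
    let P , P-def , P⇔T = T-tr (just o) (just e) (just f) (nothing ∷ just ∘ ps) in
    (λ σ → ∀ p → Lin (σ o) p (σ e) → P (maybe′ σ p))
    , def-∀ (line-def (just o) nothing (just e) def-→ P-def)
    , λ σ a e≉o f∉oe ps~a → mk⇔
        (λ ∀P x → to (P⇔T _ (x ∷ a) e≉o f∉oe (represents-∷ σ ps ps~a (λ _ → refl)))
           (∀P (scale (σ o) (σ e) x) (x , λ _ → refl)))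
        (λ ∀T p (x , p≈) →
           from (P⇔T _ (x ∷ a) e≉o f∉oe (represents-∷ σ ps ps~a p≈)) (∀T x))

  tr-≈ : (w w′ : W) → Translatable (λ a → a w ≈ a w′)
  tr-≈ w w′ o e f ps =
    (λ σ → Lift c (σ (ps w) ≐ᵖ σ (ps w′)))
    , def-⇔ (λ _ → Lift-⇔) (def-≈ (ps w) (ps w′))
    , λ σ a e≉o f∉oe ps~a → mk⇔
        (λ (lift eq) → scale-injective e≉o (λ i →
           trans (sym (ps~a w i)) (trans (eq i) (ps~a w′ i))))
        (λ aw≈ → lift (λ i →
           trans (ps~a w i) (trans (scale-cong (σ o) (σ e) aw≈ i) (sym (ps~a w′ i)))))

  -- The name `nothing` holds the value. Terms are handled through their graphs because the geometry
  -- has no function symbols.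
  Graph : ((W → Carrier) → Carrier) → (Maybe W → Carrier) → Set ℓ
  Graph g a = a nothing ≈ g (a ∘ just)

  field-graph : ∀ g → Translatable (Graph (fieldFun (underlyingField 𝔉) g))
  field-graph plus o e f ps =
    (λ σ → Lift c (Translate (σ o) (σ (ps (just 0F))) (σ (ps (just 1F))) (σ (ps nothing))))
    , def-⇔ (λ _ → Lift-⇔) (translate-def o (ps (just 0F)) (ps (just 1F)) (ps nothing))
    , λ σ a e≉o f∉oe ps~a →
        ⇔-sym Lift-⇔ ⨾ sum-⇔ e≉o (ps~a (just 0F)) (ps~a (just 1F)) (ps~a nothing)
  field-graph times o e f ps =
    (λ σ → Product (σ o) (σ e) (σ f) (σ (ps (just 0F))) (σ (ps (just 1F))) (σ (ps nothing)))
    , product-def o e f (ps (just 0F)) (ps (just 1F)) (ps nothing)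
    , λ σ a e≉o f∉oe ps~a →
        product-⇔ e≉o f∉oe (ps~a (just 0F)) (ps~a (just 1F)) (ps~a nothing)
  field-graph nought o e f ps =
    (λ σ → Lift c (σ (ps nothing) ≐ᵖ σ o))
    , def-⇔ (λ _ → Lift-⇔) (def-≈ (ps nothing) o)
    , λ σ a e≉o f∉oe ps~a → mk⇔
        (λ (lift eq) → scale-injective e≉o (λ i →
           trans (sym (ps~a nothing i)) (trans (eq i) (sym (scale-0 (σ o) (σ e) i)))))
        (λ a≈0 → lift (λ i →
           trans (ps~a nothing i) (trans (scale-cong (σ o) (σ e) a≈0 i) (scale-0 (σ o) (σ e) i))))
    where
    scale-0 : ∀ o e → scale o e 0# ≐ᵖ o
    scale-0 o e i = solve 2 (λ o e → o :+ :0 :* (e :- o) := o) refl (o i) (e i)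
  field-graph one o e f ps =
    (λ σ → Lift c (σ (ps nothing) ≐ᵖ σ e))
    , def-⇔ (λ _ → Lift-⇔) (def-≈ (ps nothing) e)
    , λ σ a e≉o f∉oe ps~a → mk⇔
        (λ (lift eq) → scale-injective e≉o (λ i →
           trans (sym (ps~a nothing i)) (trans (eq i) (sym (scale-1 (σ o) (σ e) i)))))
        (λ a≈1 → lift (λ i →
           trans (ps~a nothing i) (trans (scale-cong (σ o) (σ e) a≈1 i) (scale-1 (σ o) (σ e) i))))
    where
    scale-1 : ∀ o e → scale o e 1# ≐ᵖ e
    scale-1 o e i = solve 2 (λ o e → o :+ :1 :* (e :- o) := e) refl (o i) (e i)

  -- The values of the functions `g i` are quantified existentially as points of the first axis;
  -- their graphs determine them uniquely.
  tr-compose : ∀ {k} {T : (Fin k ⊎ W → Carrier) → Set s} {g : Fin k → (W → Carrier) → Carrier} →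
               Translatable T → (∀ i → Translatable (Graph (g i))) →
               Translatable (λ a → T [ (λ i → g i a) , a ])
  tr-compose {W = W} {k = k} {g = g} T-tr g-tr {V} o e f ps =
    let P , P-def , P⇔T = T-tr {Fin k ⊎ V} (inj₂ o) (inj₂ e) (inj₂ f) [ inj₁ , inj₂ ∘ ps ] in
    (λ σ → ∃[ qs ] (∀ i → Lin (σ o) (qs i) (σ e)) × (∀ i → G i [ qs , σ ]) × P [ qs , σ ])
    , def-∃ⁿ k (onAxis-def (inj₂ o) (inj₂ e) inj₁ def-× def-⋀ k G-def def-× P-def)
    , λ σ a e≉o f∉oe ps~a → mk⇔
        (λ (qs , qs∈ , Gqs , Pqs) →
           to (P⇔T _ _ e≉o f∉oe (λ
             -- The point `qs i` represents some scalar, and the graph condition identifies that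
             -- scalar with `g i a`.
             { (inj₁ i) j → trans (proj₂ (qs∈ i) j) (scale-cong (σ o) (σ e)
                 (to (G⇔g i _ (maybe′ a (proj₁ (qs∈ i))) e≉o f∉oe (λ
                   { nothing  → proj₂ (qs∈ i)
                   ; (just w) → ps~a w })) (Gqs i)) j)
             ; (inj₂ w) → ps~a w })) Pqs)
        (λ Ta → (λ i → scale (σ o) (σ e) (g i a)) , (λ i → g i a , λ _ → refl)
           , (λ i → from (G⇔g i _ (maybe′ a (g i a)) e≉o f∉oe (λ
               { nothing  _ → refl
               ; (just w) → ps~a w })) refl)
           , from (P⇔T _ _ e≉o f∉oe (λ { (inj₁ i) _ → refl ; (inj₂ w) → ps~a w })) Ta)
    where
    graph = λ i → g-tr i {Fin k ⊎ V} (inj₂ o) (inj₂ e) (inj₂ f) (maybe′ (inj₂ ∘ ps) (inj₁ i))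
    G : Fin k → (Fin k ⊎ V → Pt) → Set (c ⊔ ℓ)
    G i = proj₁ (graph i)
    G-def : ∀ i → Def (G i)
    G-def i = proj₁ (proj₂ (graph i))
    G⇔g = λ i → proj₂ (proj₂ (graph i))

  tr-term : (t : Term (baseSignature 𝔉) m) →
            Translatable (Graph (λ a → eval (baseStructure 𝔉) a t))
  tr-term (var i)    = tr-≈ nothing (just i)
  tr-term (fun g ts) = tr-compose
    -- `inj₁` names the values of the arguments, `inj₂ nothing` that of the whole term; the graphs
    -- of the arguments skip the latter.
    (tr-reindex (maybe′ inj₁ (inj₂ nothing)) (field-graph g))
    (λ i → tr-reindex (maybe′ (just ∘ just) nothing) (tr-term (ts i)))

tr-baseRel : (𝔉 : BaseField c ℓ) (𝒢 : CoordinateGeometry 𝔉 (suc (suc d)) r)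
             (em : ExcludedMiddle (c ⊔ ℓ)) →
             let open Translation 𝔉 𝒢 em in ∀ S → Translatable (baseRel 𝔉 S)
tr-baseRel {d = d} 𝔉@(ordered F) 𝒢 em _ o e f ps =
  (λ σ → Leq (σ o) (σ e) (σ (ps 0F)) (σ (ps 1F)))
  , def-∃ (line-def (just o) nothing (just e)
           def-× translate-def (just o) (just (ps 0F)) nothing (just (ps 1F))
           def-× (basic-def (just o) nothing (just e) def-⊎ basic-def (just o) (just e) nothing))
  , λ σ a e≉o f∉oe ps~a → leq-⇔ e≉o (ps~a 0F) (ps~a 1F)
  where
  open Translation 𝔉 𝒢 em
  open BasicDefinability 𝔉 d 𝒢 em using (basic-def)
  open OrderedGeometry F em (suc (suc d)) using (Leq; leq-⇔)

-- Defining an invariant relation in the geometry.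

module Interpretation (𝔉 : BaseField c ℓ) {d : ℕ} (𝒢 : CoordinateGeometry 𝔉 (suc (suc d)) r)
                      (em : ExcludedMiddle (c ⊔ ℓ)) where
  open Translation 𝔉 𝒢 em public

  tr-formula : (φ : Formula (baseSignature 𝔉) m) → Translatable (λ a → _⊨_ (baseStructure 𝔉) a φ)
  tr-formula (t ≐ u) = tr-⇔ (λ _ → Lift-⇔)
    (tr-compose {g = λ i a → eval (baseStructure 𝔉) a ((t ∷ u ∷ []) i)}
      (tr-≈ (inj₁ 0F) (inj₁ 1F)) (λ i → tr-term ((t ∷ u ∷ []) i)))
  tr-formula (rel S ts) = tr-⇔ (λ _ → Lift-⇔)
    (tr-compose (tr-reindex inj₁ (tr-baseRel 𝔉 𝒢 em S)) (λ i → tr-term (ts i)))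
  tr-formula ⊥̇       = tr-⇔ (λ _ → Lift-⇔) tr-⊥
  tr-formula (φ ∧̇ ψ) = tr-× (tr-formula φ) (tr-formula ψ)
  tr-formula (φ ∨̇ ψ) = tr-⊎ (tr-formula φ) (tr-formula ψ)
  tr-formula (φ ⇒̇ ψ) = tr-→ (tr-formula φ) (tr-formula ψ)
  tr-formula (∀̇ φ)   = tr-∀ (tr-formula φ)
  tr-formula (∃̇ φ)   = tr-∃ (tr-formula φ)

  -- Up to the choice of the frame, a field-definable relation is expressible in
  -- 𝒢 by letting the formula defining it speak about coordinates.
  InFrame : (Vector Pt m → Set s) → Set (lsuc (c ⊔ ℓ) ⊔ r ⊔ s)
  InFrame {m = m} R = ∀ {V : Set} (o : V) (e : Fin D → V) (ps : Fin m → V) →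
    ∃[ Q ] Def {s = c ⊔ ℓ} Q × (∀ σ qs → IsCoordinateSystem (σ o) (σ ∘ e) →
      (∀ i → σ (ps i) ≐ᵖ fromCoordinates (σ o) (σ ∘ e) (qs i)) → Q σ ⇔ R qs)

  inFrame : {R : Vector Pt m → Set s} → R Respects Pointwise _≐ᵖ_ →
            DefinableOver 𝔉 R → InFrame R
  inFrame {m = m} {R = R} R-resp (φ , R⇔φ) {V} o e ps =
    -- `e 1F`, present because the dimension is at least two, is the auxiliary point off the first
    -- axis that products need.
    let P , P-def , P⇔φ = tr-formula φ {Fin (m ℕ.* D) ⊎ V} (inj₂ o) (inj₂ (e 0F)) (inj₂ (e 1F)) inj₁ in
    (λ σ → ∃[ xs ] (∀ k → Lin (σ o) (xs k) (σ (e 0F)))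
       × (∀ i → HasCoordinates (σ o) (σ ∘ e) (σ (ps i)) (λ j → xs (combine i j)))
       × P [ xs , σ ])
    , def-∃ⁿ (m ℕ.* D)
        (onAxis-def (inj₂ o) (inj₂ (e 0F)) inj₁
         def-× def-⋀ m (λ i →
           hasCoordinates-def (inj₂ o) (inj₂ ∘ e) (inj₂ (ps i)) (λ j → inj₁ (combine i j)))
         def-× P-def)
    , λ σ qs (frame , injective , surjective) ps≈ → mk⇔
        (λ (xs , xs∈ , ps↦xs , Pxs) →
           let x = proj₁ ∘ xs∈
               -- `x` and `qs` are coordinates of the same points, hence agree by injectivity.
               x≈qs : ∀ i → (λ j → x (combine i j)) ≐ᵖ qs i
               x≈qs i = injective _ (qs i) (λ j →
                 trans (sym (to (frame-⇔ frame (λ j → proj₂ (xs∈ (combine i j)))) (ps↦xs i) j))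
                       (ps≈ i j))
           in R-resp x≈qs (from (R⇔φ x)
                (to (P⇔φ [ xs , σ ] x (proj₁ frame) (proj₂ frame 0F) (proj₂ ∘ xs∈)) Pxs)))
        (λ Rqs →
           let x = λ k → uncurry qs (remQuot D k)
               qs≈x : ∀ i → qs i ≐ᵖ (λ j → x (combine i j))
               qs≈x i j = reflexive (≡.cong (uncurry qs) (≡.sym (Fin.remQuot-combine i j)))
               xs = λ k → scale (σ o) (σ (e 0F)) (x k)
           in xs , (λ k → x k , λ _ → refl)
              , (λ i → from (frame-⇔ frame (λ _ _ → refl)) (λ j →
                   trans (ps≈ i j) (fromCoordinates-cong (σ o) (σ ∘ e) (qs≈x i) j)))
              , from (P⇔φ [ xs , σ ] x (proj₁ frame) (proj₂ frame 0F) (λ _ _ → refl))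
                  (to (R⇔φ x) (R-resp qs≈x Rqs)))

  standard : IsCoordinateSystem origin unit
  standard = (unit≉origin 0F , unit∉axis)
    , (λ x y eq i → trans (sym (fromCoordinates-unit x i)) (trans (eq i) (fromCoordinates-unit y i)))
    , (λ p → p , λ i → sym (fromCoordinates-unit p i))

  module _ (𝒢-ffd : FFD 𝒢) {R : Vector Pt n → Set s} (R-resp : R Respects Pointwise _≐ᵖ_)
           (R-def : DefinableOver 𝔉 R)
           (R-closed : ∀ f → AffineAutomorphism 𝒢 f → ClosedUnder f R) where
    open CoordinateGeometry 𝒢
    open Definability structure using (universe; def-rel; Def⇒Definable)

    private
      k : ℕ
      k = proj₁ (proj₂ 𝒢-ffd)

      symbols : Symbol ↔ Fin k
      symbols = proj₂ (proj₂ 𝒢-ffd)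

      module _ (S : Symbol) where
        private
          coordinates = inFrame (⟦⟧-resp S) (proj₁ 𝒢-ffd S) {Fin (arity S) ⊎ (Fin (suc D) ⊎ Fin n)}
                          (inj₂ (inj₁ 0F)) (inj₂ ∘ inj₁ ∘ suc) inj₁

        -- Under `inj₁` are the origin and the frame points, under `inj₂` the arguments of `R`.
        Preserved : (Fin (suc D) ⊎ Fin n → Pt) → Set (c ⊔ ℓ ⊔ r)
        Preserved σ = ∀ ps → (⟦ S ⟧ ps → proj₁ coordinates [ ps , σ ])
                           × (proj₁ coordinates [ ps , σ ] → ⟦ S ⟧ ps)

        preserved-def : Def Preserved
        preserved-def = def-∀ⁿ (arity S)
          ((def-rel S inj₁ def-→ proj₁ (proj₂ coordinates))
           def-× (proj₁ (proj₂ coordinates) def-→ def-rel S inj₁))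

        -- The translated formula at `ps` expresses `S` of the coordinates `qs`, and by preservation
        -- it also expresses `S` of `ps`.
        preserved-⇔ : ∀ {f σ} → IsCoordinateSystem (f 0F) (f ∘ suc) → Preserved [ f , σ ] →
          ∀ ps qs → (∀ i → ps i ≐ᵖ fromCoordinates (f 0F) (f ∘ suc) (qs i)) →
          ⟦ S ⟧ qs ⇔ ⟦ S ⟧ ps
        preserved-⇔ cs preserved ps qs ps≈ =
          ⇔-sym (proj₂ (proj₂ coordinates) _ qs cs ps≈)
          ⨾ mk⇔ (proj₂ (preserved ps)) (proj₁ (preserved ps))

        -- Every point is its own coordinate vector in the standard frame.
        preserved-standard : ∀ σ → Preserved [ origin ∷ unit , σ ]
        preserved-standard σ ps = to ⟦S⟧⇔ , from ⟦S⟧⇔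
          where
          ⟦S⟧⇔ = ⇔-sym (proj₂ (proj₂ coordinates) _ ps standard
                   (λ i j → sym (fromCoordinates-unit (ps i) j)))

      R-coordinates = inFrame R-resp R-def {Fin (suc D) ⊎ Fin n} (inj₁ 0F) (inj₁ ∘ suc) inj₂

      fromCoordinates-automorphism : ∀ {f : Vector Pt (suc D)} {σ} →
        IsCoordinateSystem (f 0F) (f ∘ suc) → (∀ S → Preserved S [ f , σ ]) →
        AffineAutomorphism 𝒢 (fromCoordinates (f 0F) (f ∘ suc))
      fromCoordinates-automorphism {f} cs@(_ , injective , surjective) preserved = record
        { isBijection = record
            { isInjection = record
                { isCongruent = record
                    { cong = fromCoordinates-cong (f 0F) (f ∘ suc)
                    ; isEquivalence₁ = Setoid.isEquivalence universe
                    ; isEquivalence₂ = Setoid.isEquivalence universe }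
                ; injective = injective _ _ }
            ; surjective = λ p → let x , p≈ = surjective p in
                x , λ x′≈x j → trans (fromCoordinates-cong (f 0F) (f ∘ suc) x′≈x j) (sym (p≈ j)) }
        ; preserves-fun = λ ()
        ; preserves-rel = λ S qs → preserved-⇔ S cs (preserved S) _ qs (λ _ _ → refl)
        } , fromCoordinates-affine (f 0F) (f ∘ suc) (injective _ _)
              (λ p → let x , p≈ = surjective p in x , λ j → sym (p≈ j))

      -- R holds iff it holds of the coordinates with respect to some frame that
      -- is the image of the standard one under an affine automorphism of 𝒢.
      Expressible : (Fin n → Pt) → Set (c ⊔ ℓ ⊔ r)
      Expressible σ = ∃[ f ] IsCoordinateSystem (f 0F) (f ∘ suc)
        × (∀ i → Preserved (Inverse.from symbols i) [ f , σ ])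
        × proj₁ R-coordinates [ f , σ ]

      expressible-⇔ : ∀ σ → Expressible σ ⇔ R σ
      expressible-⇔ σ = mk⇔
        (λ (f , cs@(_ , _ , surjective) , preserved , Qσ) →
           let qs = λ i → proj₁ (surjective (σ i))
               σ≈ = λ i → proj₂ (surjective (σ i))
               -- The formula is a conjunction over `Fin k`; the enumeration of the symbols extends
               -- it to all of them.
               preserved′ = λ S → ≡.subst (λ S → Preserved S [ f , σ ])
                 (Inverse.strictlyInverseʳ symbols S) (preserved (Inverse.to symbols S))
           -- `R` holds of the coordinates `qs`, and the affine automorphism given by the frame
           -- carries `qs` to `σ`.
           in R-resp (λ i j → sym (σ≈ i j))
                (R-closed _ (fromCoordinates-automorphism cs preserved′) qs
                  (to (proj₂ (proj₂ R-coordinates) _ qs cs σ≈) Qσ)))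
        (λ Rσ → (origin ∷ unit) , standard
           , (λ i → preserved-standard (Inverse.from symbols i) σ)
           , from (proj₂ (proj₂ R-coordinates) _ σ standard
               (λ i j → sym (fromCoordinates-unit (σ i) j))) Rσ)

    affine-invariant⇒concept : Concept 𝒢 R
    affine-invariant⇒concept = Def⇒Definable (def-⇔ expressible-⇔ (def-∃ⁿ (suc D)
      (coordinateSystem-def (inj₁ 0F) (inj₁ ∘ suc)
       def-× def-⋀ k (λ i → preserved-def (Inverse.from symbols i))
       def-× proj₁ (proj₂ R-coordinates))))

-- Concepts are definable over the field.

module _ {𝔉 : BaseField c ℓ} {d : ℕ} (𝒢 : CoordinateGeometry 𝔉 d r) (𝒢-def : FieldDefinable 𝒢) where
  open CoordinateGeometry 𝒢
  private
    module G = Definability structure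
  open Definability (baseStructure 𝔉)

  private
    coordinates : (Fin m → Fin d → V) → Term signature m → Fin d → V
    coordinates x (var i) = x i

    eval-coordinates : (x : Fin m → Fin d → V) (t : Term signature m) (σ : V → Carrier) →
                       ∀ j → eval structure (λ i j → σ (x i j)) t j ≈ σ (coordinates x t j)
    eval-coordinates x (var i) σ j = refl

  -- Each point variable is replaced by `d` scalar variables, and a quantifier over points by a
  -- block of `d` quantifiers over scalars.
  def-coordinates : (φ : Formula signature m) (x : Fin m → Fin d → V) →
                    Def (λ σ → _⊨_ structure (λ i j → σ (x i j)) φ)
  def-coordinates (t ≐ u) x = def-⇔
    (λ σ → mk⇔
      (λ eq j → trans (eval-coordinates x t σ j) (trans (eq j) (sym (eval-coordinates x u σ j))))
      (λ eq j → trans (sym (eval-coordinates x t σ j)) (trans (eq j) (eval-coordinates x u σ j)))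
      ⨾ Lift-⇔)
    (def-⋀ d (λ j → def-≈ (coordinates x t j) (coordinates x u j)))
  def-coordinates {V = V} (rel S ts) x = def-⇔
    (λ σ → let
         eq : ∀ i j → σ (xs (combine i j)) ≈ eval structure (λ i j → σ (x i j)) (ts i) j
         eq i j = trans
           (reflexive (≡.cong (λ (i , j) → σ (coordinates x (ts i) j)) (Fin.remQuot-combine i j)))
           (sym (eval-coordinates x (ts i) σ j))
       in mk⇔ (⟦⟧-resp S eq) (⟦⟧-resp S (λ i j → sym (eq i j))) ⨾ Lift-⇔)
    (def-reindex xs (Definable⇒Def (𝒢-def S)))
    where
    xs : Fin (arity S ℕ.* d) → V
    xs k = let i , j = remQuot d k in coordinates x (ts i) j
  def-coordinates ⊥̇       x = def-⇔ (λ _ → Lift-⇔) def-⊥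
  def-coordinates (φ ∧̇ ψ) x = def-coordinates φ x def-× def-coordinates ψ x
  def-coordinates (φ ∨̇ ψ) x = def-coordinates φ x def-⊎ def-coordinates ψ x
  def-coordinates (φ ⇒̇ ψ) x = def-coordinates φ x def-→ def-coordinates ψ x
  def-coordinates (∀̇ φ)   x = def-⇔
    (λ σ → ∀-⇔ (λ p → G.⊨-cong (λ { zero _ → refl ; (suc i) _ → refl }) φ))
    (def-∀ⁿ d (def-coordinates φ (inj₁ ∷ (λ i → inj₂ ∘ x i))))
  def-coordinates (∃̇ φ)   x = def-⇔
    (λ σ → ∃-⇔ (λ p → G.⊨-cong (λ { zero _ → refl ; (suc i) _ → refl }) φ))
    (def-∃ⁿ d (def-coordinates φ (inj₁ ∷ (λ i → inj₂ ∘ x i))))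

  concept⇒definableOver : {R : Vector (Point 𝔉 d) n → Set s} → Concept 𝒢 R → DefinableOver 𝔉 R
  concept⇒definableOver (φ , R⇔φ) = Def⇒Definable (def-⇔
    (λ σ → ⇔-sym (R⇔φ _)) (def-coordinates φ combine))

-- The cycle of implications from (i) to (ii) to (iii) and back to (i).

open import Data.Nat.Base using (_≤_)

theorem1 : ∀ {c ℓ r s : Level} →
    ExcludedMiddle (c ⊔ ℓ ⊔ r ⊔ s) →
    (d : ℕ) → 2 ≤ d →
    (𝔉 : BaseField c ℓ) →
    (𝒢 : CoordinateGeometry 𝔉 d r) → FFD 𝒢 →
    (n : ℕ) → 1 ≤ n →
    (R : Vector (Point 𝔉 d) n → Set s) → R Respects Pointwise (PointEq 𝔉 d) →
    (Concept 𝒢 R ⇔ (DefinableOver 𝔉 R × (∀ f → Automorphism 𝒢 f → ClosedUnder f R)))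
    × ((DefinableOver 𝔉 R × (∀ f → Automorphism 𝒢 f → ClosedUnder f R))
       ⇔ (DefinableOver 𝔉 R × (∀ f → AffineAutomorphism 𝒢 f → ClosedUnder f R)))
theorem1 {c} {ℓ} {r} {s} em (suc (suc d)) (s≤s (s≤s z≤n)) 𝔉 𝒢 𝒢-ffd n _ R R-resp =
  mk⇔ i⇒ii (iii⇒i ∘ ii⇒iii) , mk⇔ ii⇒iii (i⇒ii ∘ iii⇒i)
  where
  i⇒ii : Concept 𝒢 R → DefinableOver 𝔉 R × (∀ f → Automorphism 𝒢 f → ClosedUnder f R)
  i⇒ii R-concept = concept⇒definableOver 𝒢 (proj₁ 𝒢-ffd) R-concept
    , Definability.Definable-closed (CoordinateGeometry.structure 𝒢) R-concept
  ii⇒iii : DefinableOver 𝔉 R × (∀ f → Automorphism 𝒢 f → ClosedUnder f R) →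
           DefinableOver 𝔉 R × (∀ f → AffineAutomorphism 𝒢 f → ClosedUnder f R)
  ii⇒iii (R-def , closed) = R-def , λ f f-affine → closed f (proj₁ f-affine)
  iii⇒i : DefinableOver 𝔉 R × (∀ f → AffineAutomorphism 𝒢 f → ClosedUnder f R) → Concept 𝒢 R
  iii⇒i (R-def , closed) = Interpretation.affine-invariant⇒concept 𝔉 𝒢
    (lower-em {c ⊔ ℓ} (r ⊔ s) em) 𝒢-ffd R-resp R-def closed
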